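{- Let $n\ge0$ and let $H_n$ be the pyrene system with $n$ pyrene fragments. Then $$Af(H_n,x)=x^{n}\sum_{l=0}^{2n}\sum_{i=\lceil\frac{l+2n}{4}\rceil}^{n}\sum_{j=\lceil\frac{l}{2}\rceil}^{l}(-1)^{n-i}2^{2i-n}\binom{i}{2i-n}\binom{2i-n}{j}\binom{j}{l-j}x^{l}.$$
   Context: Pyrene system: draw the hexagonal lattice so that every hexagon has two vertical sides; horizontally adjacent hexagons then share a vertical edge. For $n\ge1$, $H_n$ is the hexagonal system (the plane graph formed by the vertices and edges of the following $4n$ hexagons) consisting of a horizontal linear row of $2n$ hexagons $h_{1,1},h_{1,2},\dots,h_{n,1},h_{n,2}$, consecutive ones sharing a vertical edge, together with, for each $i$, a hexagon $s_{i,1}$ directly above and a hexagon $s_{i,2}$ directly below the common edge of $h_{i,1}$ and $h_{i,2}$ (each sharing an edge with both $h_{i,1}$ and $h_{i,2}$). $H_0$ is the null graph (anti-forcing polynomial $1$). For a perfect matching $M$ of $G$, an anti-forcing set of $M$ is a set $S\subseteq E(G)\setminus M$ such that $M$ is the unique perfect matching of $G-S$; the anti-forcing number $af(G,M)$ is the minimum size of an anti-forcing set of $M$. The anti-forcing polynomial is $Af(G,x)=\sum_{M\in\mathcal{M}(G)}x^{af(G,M)}$, where $\mathcal{M}(G)$ is the set of perfect matchings of $G$. Binomial coefficients $\binom{a}{b}$ are $0$ when $b<0$ or $b>a$. -}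

module Defs where

open import Data.Bool.Properties using () renaming (_≟_ to _≟ᵇ_)
open import Data.Fin using (Fin)
open import Data.Fin.Properties using (any?; all?) renaming (_≟_ to _≟ᶠ_)
open import Data.Fin.Subset using (Subset; inside; outside; ⊤; ∁; ∣_∣) renaming (_∈_ to _∈ˢ_; _⊆_ to _⊆ˢ_)
open import Data.Fin.Subset.Properties using (anySubset?; ⊆-refl; ⊆-antisym; x∉p⇒x∈∁p; x∉∁p⇒x∈p; x∈∁p⇒x∉p) renaming (_∈?_ to _∈ˢ?_; _⊆?_ to _⊆ˢ?_)
open import Data.Integer using (ℤ; 0ℤ; 1ℤ) renaming (_+_ to _+ᶻ_)
open import Data.List using (List; []; _∷_; [_]; _++_; map; foldr; filter; concatMap; deduplicate; replicate; length; lookup; upTo)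
open import Data.List.Extrema.Nat using (min; min≤v⁺; argmin-sel)
open import Data.List.Membership.Propositional using (_∈_; find; lose)
open import Data.List.Membership.Propositional.Properties using (∈-lookup; ∈-map⁺; ∈-map⁻; ∈-++⁺ˡ; ∈-++⁺ʳ; ∈-filter⁺; ∈-filter⁻; ∈-deduplicate⁺; ∈-deduplicate⁻; ∈-concatMap⁺; ∈-concatMap⁻)
open import Data.List.Relation.Unary.All using (All; []; _∷_) renaming (all? to allᴸ?; lookup to All-lookup; tabulate to All-tabulate)
open import Data.List.Relation.Unary.Any using (here; there)
open import Data.List.Relation.Unary.Unique.Propositional using (Unique)
import Data.List.Relation.Unary.Unique.DecPropositional.Properties as UniqueDec
open import Data.Nat using (ℕ; zero; suc; _+_; _*_; _∸_; _/_; _≤_; NonZero)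
open import Data.Nat.Properties using (≤-reflexive) renaming (_≟_ to _≟ⁿ_)
open import Data.Product using (∃; ∃!; _×_; _,_; proj₁; proj₂)
open import Data.Product.Properties using (≡-dec)
open import Data.Sum using (_⊎_; inj₁; inj₂)
open import Data.Vec using ([]; _∷_)
import Data.Vec.Properties as Vec
open import Relation.Binary.Definitions using (DecidableEquality)
open import Relation.Binary.PropositionalEquality using (_≡_; refl; sym; trans; subst)
open import Relation.Nullary using (Dec; ¬?; map′; _×-dec_; _⊎-dec_; _→-dec_; decidable-stable)
open import Relation.Unary using (Decidable)

------------------------------------------------------------------------
-- Finite graphs

-- An edge {u , v} is listed once, in one of its two orientations; a set of
-- edges is a subset of the index set of the list of edges.
record Graph : Set₁ where
  field
    Vertex         : Set
    _≟_            : DecidableEquality Vertex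
    vertices       : List Vertex
    edges          : List (Vertex × Vertex)
    edges-unique   : Unique edges
    edges⊆vertices : All (λ (u , v) → u ∈ vertices × v ∈ vertices) edges

  Edge : Set
  Edge = Fin (length edges)

  EdgeSet : Set
  EdgeSet = Subset (length edges)

  _isEndOf_ : Vertex → Edge → Set
  v isEndOf e = v ≡ proj₁ (lookup edges e) ⊎ v ≡ proj₂ (lookup edges e)

  _isEndOf?_ : ∀ v e → Dec (v isEndOf e)
  v isEndOf? e = (v ≟ proj₁ (lookup edges e)) ⊎-dec (v ≟ proj₂ (lookup edges e))

subsets : ∀ m → List (Subset m)
subsets zero    = [ [] ]
subsets (suc m) = map (inside ∷_) (subsets m) ++ map (outside ∷_) (subsets m)

∈-subsets : ∀ {m} (p : Subset m) → p ∈ subsets m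
∈-subsets []            = here refl
∈-subsets (inside  ∷ p) = ∈-++⁺ˡ (∈-map⁺ (inside ∷_) (∈-subsets p))
∈-subsets (outside ∷ p) = ∈-++⁺ʳ (map (inside ∷_) (subsets _)) (∈-map⁺ (outside ∷_) (∈-subsets p))

allSubsets? : ∀ {m} {P : Subset m → Set} → Decidable P → Dec (∀ p → P p)
allSubsets? P? = map′
  (λ ¬∃¬ p → decidable-stable (P? p) (λ ¬Pp → ¬∃¬ (p , ¬Pp)))
  (λ ∀P (p , ¬Pp) → ¬Pp (∀P p))
  (¬? (anySubset? (λ p → ¬? (P? p))))

------------------------------------------------------------------------
-- Perfect matchings and anti-forcing sets

module _ (G : Graph) where
  open Graph G

  -- M is a perfect matching of the spanning subgraph of G with edge set F.
  IsPerfectMatchingOf : EdgeSet → EdgeSet → Set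
  IsPerfectMatchingOf F M =
    M ⊆ˢ F × All (λ v → ∃! _≡_ (λ e → e ∈ˢ M × v isEndOf e)) vertices

  IsPerfectMatching : EdgeSet → Set
  IsPerfectMatching = IsPerfectMatchingOf ⊤

  -- The edge set of G - S is ∁ S.
  IsAntiForcingSet : EdgeSet → EdgeSet → Set
  IsAntiForcingSet M S =
    S ⊆ˢ ∁ M ×
    IsPerfectMatchingOf (∁ S) M ×
    (∀ M′ → IsPerfectMatchingOf (∁ S) M′ → M′ ≡ M)

  isPerfectMatchingOf? : ∀ F M → Dec (IsPerfectMatchingOf F M)
  isPerfectMatchingOf? F M = (M ⊆ˢ? F) ×-dec allᴸ? exactlyOne? vertices
    where
    covers? : ∀ v e → Dec (e ∈ˢ M × v isEndOf e)
    covers? v e = (e ∈ˢ? M) ×-dec (v isEndOf? e)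

    exactlyOne? : ∀ v → Dec (∃! _≡_ (λ e → e ∈ˢ M × v isEndOf e))
    exactlyOne? v = any? λ e → covers? v e ×-dec
      map′ (λ h {f} → h f) (λ h f → h {f}) (all? λ f → covers? v f →-dec (e ≟ᶠ f))

  isPerfectMatching? : Decidable IsPerfectMatching
  isPerfectMatching? = isPerfectMatchingOf? ⊤

  isAntiForcingSet? : ∀ M S → Dec (IsAntiForcingSet M S)
  isAntiForcingSet? M S =
    (S ⊆ˢ? ∁ M) ×-dec (isPerfectMatchingOf? (∁ S) M ×-dec
    allSubsets? (λ M′ → isPerfectMatchingOf? (∁ S) M′ →-dec Vec.≡-dec _≟ᵇ_ M′ M))

  perfectMatchings : List EdgeSet
  perfectMatchings = filter isPerfectMatching? (subsets (length edges))

  antiForcingSets : EdgeSet → List EdgeSet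
  antiForcingSets M = filter (isAntiForcingSet? M) (subsets (length edges))

  -- The default value ∣ ∁ M ∣ does not affect the minimum when M is a perfect
  -- matching, as ∁ M is then an anti-forcing set of M (see af-attained).
  af : EdgeSet → ℕ
  af M = min ∣ ∁ M ∣ (map ∣_∣ (antiForcingSets M))

  af-attained : ∀ {M} → IsPerfectMatching M → ∃ λ S → IsAntiForcingSet M S × ∣ S ∣ ≡ af M
  af-minimal  : ∀ {M S} → IsAntiForcingSet M S → af M ≤ ∣ S ∣

  af-attained {M} pm@(_ , cover)
    with argmin-sel (λ k → k) ∣ ∁ M ∣ (map ∣_∣ (antiForcingSets M))
  ... | inj₁ eq = ∁ M , (⊆-refl , (M⊆∁∁M , cover) , unique) , sym eq
    where
    M⊆∁∁M : M ⊆ˢ ∁ (∁ M)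
    M⊆∁∁M e∈M = x∉p⇒x∈∁p (λ e∈∁M → x∈∁p⇒x∉p e∈∁M e∈M)

    unique : ∀ M′ → IsPerfectMatchingOf (∁ (∁ M)) M′ → M′ ≡ M
    unique M′ (M′⊆ , cover′) = ⊆-antisym M′⊆M M⊆M′
      where
      M′⊆M : M′ ⊆ˢ M
      M′⊆M e∈M′ = x∉∁p⇒x∈p (x∈∁p⇒x∉p (M′⊆ e∈M′))

      M⊆M′ : M ⊆ˢ M′
      M⊆M′ {e} e∈M
        with u∈ ← proj₁ (All-lookup edges⊆vertices (∈-lookup {xs = edges} e))
        with f , (f∈M′ , u-f) , _ ← All-lookup cover′ u∈
           | g , _ , g-only ← All-lookup cover u∈
        = subst (_∈ˢ M′) (trans (sym (g-only (M′⊆M f∈M′ , u-f))) (g-only (e∈M , inj₁ refl))) f∈M′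
  ... | inj₂ k∈ with ∈-map⁻ ∣_∣ k∈
  ...   | S , S∈ , eq = S , proj₂ (∈-filter⁻ (isAntiForcingSet? M) {xs = subsets _} S∈) , sym eq

  af-minimal {M} {S} afs = min≤v⁺ ∣ ∁ M ∣ _ (inj₂ (lose
    (∈-map⁺ ∣_∣ (∈-filter⁺ (isAntiForcingSet? M) (∈-subsets S) afs)) (≤-reflexive refl)))

------------------------------------------------------------------------
-- Polynomials in one variable over ℤ

-- Coefficient lists, constant term first; trailing zeros are allowed, so
-- equality is coefficientwise.
Poly : Set
Poly = List ℤ

coeff : Poly → ℕ → ℤ
coeff []      _       = 0ℤ
coeff (a ∷ p) zero    = a
coeff (a ∷ p) (suc k) = coeff p k

infix 4 _≈ₚ_
_≈ₚ_ : Poly → Poly → Set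
p ≈ₚ q = ∀ k → coeff p k ≡ coeff q k

infixl 6 _+ₚ_
_+ₚ_ : Poly → Poly → Poly
[]      +ₚ q       = q
(a ∷ p) +ₚ []      = a ∷ p
(a ∷ p) +ₚ (b ∷ q) = (a +ᶻ b) ∷ (p +ₚ q)

infixr 7 x^_·_
x^_·_ : ℕ → Poly → Poly
x^ k · p = replicate k 0ℤ ++ p

const : ℤ → Poly
const a = [ a ]

sumₚ : List Poly → Poly
sumₚ = foldr _+ₚ_ []

-- a, a + 1, …, b; empty if a > b.
range : ℕ → ℕ → List ℕ
range a b = map (a +_) (upTo (suc b ∸ a))

sumFromTo : ℕ → ℕ → (ℕ → Poly) → Poly
sumFromTo a b f = sumₚ (map f (range a b))

infix 5 sumFromTo
syntax sumFromTo a b (λ i → p) = Σ[ i from a to b ] p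

⌈_/_⌉ : (m d : ℕ) → .{{NonZero d}} → ℕ
⌈ m / d ⌉ = (m + (d ∸ 1)) / d

Af : Graph → Poly
Af G = sumₚ (map (λ M → x^ af G M · const 1ℤ) (perfectMatchings G))

------------------------------------------------------------------------
-- Hexagonal systems

-- The hexagonal lattice in brick-wall coordinates: (x , y) is the x-th vertex,
-- from left to right, of the y-th horizontal zigzag, from bottom to top.
Point : Set
Point = ℕ × ℕ

_≟ᵖ_ : DecidableEquality Point
_≟ᵖ_ = ≡-dec _≟ⁿ_ _≟ⁿ_

-- A hexagon is named by its lower left vertex (x , y).  Its vertical sides are
-- at abscissas x and x + 2, so (x , y) and (x′ , y′) name hexagons of the same
-- lattice when x + y and x′ + y′ have the same parity.
hexagonVertices : Point → List Point
hexagonVertices (x , y) =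
  (x , y) ∷ (1 + x , y) ∷ (2 + x , y) ∷
  (x , 1 + y) ∷ (1 + x , 1 + y) ∷ (2 + x , 1 + y) ∷ []

-- Edges are oriented to the right or upwards, so that an edge common to two
-- hexagons is given by the same pair in both.
hexagonEdges : Point → List (Point × Point)
hexagonEdges (x , y) =
  ((x , y) , (1 + x , y)) ∷ ((1 + x , y) , (2 + x , y)) ∷
  ((x , 1 + y) , (1 + x , 1 + y)) ∷ ((1 + x , 1 + y) , (2 + x , 1 + y)) ∷
  ((x , y) , (x , 1 + y)) ∷ ((2 + x , y) , (2 + x , 1 + y)) ∷ []

hexagonalSystem : List Point → Graph
hexagonalSystem hs = record
  { Vertex         = Point
  ; _≟_            = _≟ᵖ_
  ; vertices       = deduplicate _≟ᵖ_ (concatMap hexagonVertices hs)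
  ; edges          = deduplicate _≟ᵉ_ (concatMap hexagonEdges hs)
  ; edges-unique   = UniqueDec.deduplicate-! _≟ᵉ_ (concatMap hexagonEdges hs)
  ; edges⊆vertices = All-tabulate closed
  }
  where
  _≟ᵉ_ : DecidableEquality (Point × Point)
  _≟ᵉ_ = ≡-dec _≟ᵖ_ _≟ᵖ_

  ends : ∀ h → All (λ (u , v) → u ∈ hexagonVertices h × v ∈ hexagonVertices h) (hexagonEdges h)
  ends h = (v₀ , v₁) ∷ (v₁ , v₂) ∷ (v₃ , v₄) ∷ (v₄ , v₅) ∷ (v₀ , v₃) ∷ (v₂ , v₅) ∷ []
    where
    v₀ = here refl
    v₁ = there (here refl)
    v₂ = there (there (here refl))
    v₃ = there (there (there (here refl)))
    v₄ = there (there (there (there (here refl))))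
    v₅ = there (there (there (there (there (here refl)))))

  vertex∈ : ∀ {h v} → h ∈ hs → v ∈ hexagonVertices h →
            v ∈ deduplicate _≟ᵖ_ (concatMap hexagonVertices hs)
  vertex∈ h∈ v∈ = ∈-deduplicate⁺ _≟ᵖ_ (∈-concatMap⁺ hexagonVertices (lose h∈ v∈))

  closed : ∀ {e} → e ∈ deduplicate _≟ᵉ_ (concatMap hexagonEdges hs) →
           proj₁ e ∈ deduplicate _≟ᵖ_ (concatMap hexagonVertices hs) ×
           proj₂ e ∈ deduplicate _≟ᵖ_ (concatMap hexagonVertices hs)
  closed e∈
    with h , h∈ , e∈h ← find (∈-concatMap⁻ hexagonEdges {xs = hs}
                                (∈-deduplicate⁻ _≟ᵉ_ (concatMap hexagonEdges hs) e∈))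
    with u∈ , v∈ ← All-lookup (ends h) e∈h
    = vertex∈ h∈ u∈ , vertex∈ h∈ v∈

-- The hexagons h_{i+1,1}, h_{i+1,2}, s_{i+1,1}, s_{i+1,2}.
pyreneFragment : ℕ → List Point
pyreneFragment i =
  (4 * i , 1) ∷ (2 + 4 * i , 1) ∷ (1 + 4 * i , 2) ∷ (1 + 4 * i , 0) ∷ []

H : ℕ → Graph
H n = hexagonalSystem (concatMap pyreneFragment (upTo n))

{-# OPTIONS --safe #-}

-- A perfect matching of H n restricts to each pyrene fragment in one of six ways A, B, LL, RR,
-- LR, RL, and the perfect matchings are the words of length n without the factor BA.  The
-- anti-forcing number of a word is the sum of the weights of its letters, 1 for A and B, 2 for
-- LR and RL, 3 for LL and RR: an anti-forcing set of that size is explicit, and conversely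
-- each letter of weight w admits w flips to other perfect matchings such that the edges
-- introduced by all these flips are pairwise distinct; an anti-forcing set contains one of each.
-- Hence Af(H n) = xⁿ Uₙ with Uₙ₊₂ = 2 (1 + x + x²) Uₙ₊₁ − Uₙ, and the triple sum is the
-- expansion of this Chebyshev-like polynomial in powers of 2 (1 + x + x²).
module Submission where

open import Defs
open import Data.Nat using (ℕ; _+_; _*_; _∸_; _^_)
open import Data.Nat.Combinatorics using (_C_)
open import Data.Integer using (+_; -1ℤ) renaming (_*_ to _*ᶻ_; _^_ to _^ᶻ_)
open import Data.Bool using (Bool; true; false; _∧_; _∨_; not; if_then_else_; T)
open import Data.Bool.Properties using () renaming (_≟_ to _≟ᵇ_)
open import Data.Empty using (⊥; ⊥-elim)
open import Data.Fin using (Fin; #_; toℕ) renaming (zero to fzero; suc to fsuc; _≟_ to _≟ᶠ_)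
open import Data.Fin.Properties using (any?; toℕ<n; toℕ-injective)
open import Data.Fin.Subset using (Subset; inside; outside; ∁; ∣_∣) renaming (_∈_ to _∈ˢ_; _∉_ to _∉ˢ_; ⊥ to ∅)
open import Data.Fin.Subset.Properties using (∈⊤; ∉⊥; ∣⊥∣≡0; p⊆q⇒∣p∣≤∣q∣; x∉p⇒x∈∁p; x∈∁p⇒x∉p) renaming (_∈?_ to _∈ˢ?_)
open import Data.Integer using (ℤ; 0ℤ; 1ℤ) renaming (_+_ to _+ᶻ_; _-_ to _-ᶻ_)
import Data.Integer.Properties as ℤ
open import Data.Integer.Tactic.RingSolver using (solve-∀)
open import Data.List using (List; []; _∷_; map; _++_; length; filter; foldr; concatMap; lookup; upTo; applyUpTo)
open import Data.List.Membership.Propositional using (_∈_; find; lose)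
open import Data.List.Membership.Propositional.Properties using (∈-lookup; ∈-map⁺; ∈-map⁻; ∈-++⁺ˡ; ∈-++⁺ʳ; ∈-++⁻; ∈-filter⁺; ∈-filter⁻; ∈-concatMap⁺; ∈-concatMap⁻; ∈-deduplicate⁺; ∈-deduplicate⁻; ∈-upTo⁺; ∈-upTo⁻)
open import Data.List.Membership.Propositional.Properties.WithK using (unique∧set⇒bag)
open import Data.List.Properties using (∷-injective; ∷-injectiveˡ; length-++; length-map; length-upTo; map-∘; map-upTo; map-applyUpTo)
open import Data.List.Relation.Binary.BagAndSetEquality using (∼bag⇒↭)
open import Data.List.Relation.Binary.Permutation.Propositional using (_↭_; prep; swap) renaming (refl to ↭-refl; trans to ↭-trans)
open import Data.List.Relation.Unary.All as All using (All; []; _∷_; all?)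
import Data.List.Relation.Unary.All.Properties as All
open import Data.List.Relation.Unary.AllPairs using ([]; _∷_)
open import Data.List.Relation.Unary.Any as Any using (here; there)
open import Data.List.Relation.Unary.Any.Properties using (lookup-index)
import Data.List.Relation.Unary.Unique.DecPropositional as DecUnique
open import Data.List.Relation.Unary.Unique.Propositional using (Unique)
import Data.List.Relation.Unary.Unique.Propositional.Properties as Unique
open import Data.Nat using (zero; suc; _<_; _≤_; z≤n; s≤s; _≡ᵇ_; _<ᵇ_; _≟_; NonZero)
open import Data.Nat.Combinatorics using (k>n⇒nCk≡0; nCk≡nC[n∸k]; nCk+nC[k+1]≡[n+1]C[k+1])
open import Data.Nat.DivMod using (_/_; _%_; m/n*n≤m; m≡m%n+[m/n]*n; m%n<n; m<n⇒m%n≡m; [m+kn]%n≡m%n)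
open import Data.Nat.ListAction using (sum)
open import Data.Nat.Properties hiding (_≟_)
open import Data.Product using (_×_; _,_; proj₁; proj₂; ∃; ∃₂; ∃!; uncurry)
open import Data.Product.Properties using (≡-dec; ,-injective)
open import Data.Sum using (_⊎_; inj₁; inj₂)
open import Data.Unit using (tt)
open import Data.Vec as Vec using (_[_]≔_; here; there)
import Data.Vec.Properties as Vec
open import Function using (_∘_; id; mk⇔)
open import Relation.Binary.Definitions using (DecidableEquality)
open import Relation.Binary.PropositionalEquality using (_≡_; refl; sym; trans; cong; cong₂; subst; module ≡-Reasoning)
open import Relation.Nullary using (¬_; Dec; yes; no; map′; _×-dec_; _⊎-dec_; _→-dec_)
open import Relation.Nullary.Decidable using (T?; toWitness)
open import Relation.Unary using (Decidable)

-- Words and flips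

-- The restriction of a perfect matching to a fragment.  A (resp. B) contains the vertical edge in
-- the middle and matches both ends of the left (resp. right) vertical edge inside the
-- fragment; in the other four, two letters tell on which side the upper and the lower
-- hexagons have their vertical edge in the matching.
data Letter : Set where
  A B LL RR LR RL : Letter

-- The edges of a fragment, except its right vertical side, which is the post of the next one:
-- the subscript is the abscissa of the left end, relative to the fragment.  hi and lo are on the
-- two long zigzags, top and bot on the short ones, post and mid join the long zigzags (at
-- abscissas 0 and 2), up and down join a long zigzag to a short one.
data Kind : Set where
  top₁ top₂ bot₁ bot₂ up₁ up₃ down₁ down₃ hi₀ hi₁ hi₂ hi₃ lo₀ lo₁ lo₂ lo₃ mid post : Kind

isA isB : Letter → Bool
isA A = true
isA _ = false
isB B = true
isB _ = false

upLeft downLeft midUsed : Letter → Bool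
upLeft B  = true
upLeft LL = true
upLeft LR = true
upLeft _  = false
downLeft B  = true
downLeft LL = true
downLeft RL = true
downLeft _  = false
midUsed l = isA l ∨ isB l

wt : Letter → ℕ
wt A  = 1
wt B  = 1
wt LL = 3
wt RR = 3
wt LR = 2
wt RL = 2

used : Kind → Letter → Letter → Bool
used post a b  = not (isB a) ∧ not (isA b)
used mid a b   = midUsed b
used up₁ a b   = upLeft b
used up₃ a b   = not (upLeft b)
used top₁ a b  = not (upLeft b)
used top₂ a b  = upLeft b
used hi₀ a b   = isA b
used hi₁ a b   = not (midUsed b) ∧ not (upLeft b)
used hi₂ a b   = not (midUsed b) ∧ upLeft b
used hi₃ a b   = isB b
used down₁ a b = downLeft b
used down₃ a b = not (downLeft b)
used bot₁ a b  = not (downLeft b)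
used bot₂ a b  = downLeft b
used lo₀ a b   = isA b
used lo₁ a b   = not (midUsed b) ∧ not (downLeft b)
used lo₂ a b   = not (midUsed b) ∧ downLeft b
used lo₃ a b   = isB b

ok : Letter → Letter → Bool
ok a b = not (isB a ∧ isA b)

-- Only the first n letters matter for H n; the others are RR, which constrains no neighbour.
Word : Set
Word = ℕ → Letter

prev : Letter → Word → Word
prev p f zero    = p
prev p f (suc j) = prev (f 0) (f ∘ suc) j

prev-suc : ∀ p f j → prev p f (suc j) ≡ f j
prev-suc p f zero    = refl
prev-suc p f (suc j) = prev-suc (f 0) (f ∘ suc) j

Valid : Letter → Word → Set
Valid p f = ∀ j → T (ok (prev p f j) (f j))

covers : Letter → Word → ℕ → Kind → Bool
covers p f j k = used k (prev p f j) (f j)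

set₂ : Word → ℕ → Letter → Letter → Word
set₂ f zero    x y zero          = x
set₂ f zero    x y (suc zero)    = y
set₂ f zero    x y (suc (suc j)) = f (suc (suc j))
set₂ f (suc i) x y zero          = f 0
set₂ f (suc i) x y (suc j)       = set₂ (f ∘ suc) i x y j

rank : Kind → ℕ
rank top₁  = 0
rank top₂  = 0
rank up₁   = 0
rank up₃   = 0
rank hi₁   = 0
rank hi₂   = 0
rank bot₁  = 1
rank bot₂  = 1
rank down₁ = 1
rank down₃ = 1
rank lo₁   = 1
rank lo₂   = 1
rank _     = 2

-- The new edges of the flips of a word are pairwise disjoint, and own k a b names the only flip
-- that may introduce an edge of kind k into a fragment with letter b preceded by a: in
-- (s , c), s is 0, 1 or 2 if the flipped fragment is the previous one, this one or the next
-- one, and c is the number of the flip.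
own : Kind → Letter → Letter → ℕ × ℕ
own post _ b = if isA b then (1 , 0) else (0 , 0)
own hi₁  _ A = 1 , 0
own lo₁  _ A = 1 , 0
own hi₂  _ B = 1 , 0
own lo₂  _ B = 1 , 0
own _    _ A = 0 , 2
own _    _ B = 2 , 2
own k    _ _ = 1 , rank k

letters : List Letter
letters = A ∷ B ∷ LL ∷ RR ∷ LR ∷ RL ∷ []

∈-letters : ∀ l → l ∈ letters
∈-letters A  = ∈-lookup (# 0)
∈-letters B  = ∈-lookup (# 1)
∈-letters LL = ∈-lookup (# 2)
∈-letters RR = ∈-lookup (# 3)
∈-letters LR = ∈-lookup (# 4)
∈-letters RL = ∈-lookup (# 5)

kinds : List Kind
kinds = top₁ ∷ top₂ ∷ bot₁ ∷ bot₂ ∷ up₁ ∷ up₃ ∷ down₁ ∷ down₃ ∷ hi₀ ∷ hi₁ ∷ hi₂ ∷ hi₃ ∷ lo₀ ∷ lo₁ ∷ lo₂ ∷ lo₃ ∷ mid ∷ post ∷ []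

∈-kinds : ∀ k → k ∈ kinds
∈-kinds top₁  = ∈-lookup (# 0)
∈-kinds top₂  = ∈-lookup (# 1)
∈-kinds bot₁  = ∈-lookup (# 2)
∈-kinds bot₂  = ∈-lookup (# 3)
∈-kinds up₁   = ∈-lookup (# 4)
∈-kinds up₃   = ∈-lookup (# 5)
∈-kinds down₁ = ∈-lookup (# 6)
∈-kinds down₃ = ∈-lookup (# 7)
∈-kinds hi₀   = ∈-lookup (# 8)
∈-kinds hi₁   = ∈-lookup (# 9)
∈-kinds hi₂   = ∈-lookup (# 10)
∈-kinds hi₃   = ∈-lookup (# 11)
∈-kinds lo₀   = ∈-lookup (# 12)
∈-kinds lo₁   = ∈-lookup (# 13)
∈-kinds lo₂   = ∈-lookup (# 14)
∈-kinds lo₃   = ∈-lookup (# 15)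
∈-kinds mid   = ∈-lookup (# 16)
∈-kinds post  = ∈-lookup (# 17)

module Exhaustion {X : Set} {xs : List X} (∈-xs : ∀ x → x ∈ xs) where
  ∀? : ∀ {P : X → Set} → Decidable P → Dec (∀ x → P x)
  ∀? P? = map′ (λ h x → All.lookup h (∈-xs x)) (λ h → All.tabulate (λ {x} _ → h x)) (all? P? xs)

open Exhaustion ∈-letters using () renaming (∀? to ∀letter?)
open Exhaustion ∈-kinds using () renaming (∀? to ∀kind?)

shift : ℕ → ℕ × ℕ → ℕ × ℕ
shift d (s , c) = s + d , c

Added : Letter → Letter → Letter → Letter → ℕ → ℕ × ℕ → Set
Added a b x y d t = ∀ k → T (used k x y) → T (not (used k a b)) → shift d (own k a b) ≡ t

added? : ∀ a b x y d t → Dec (Added a b x y d t)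
added? a b x y d t = ∀kind? λ k → T? (used k x y) →-dec (T? (not (used k a b)) →-dec ≡-dec _≟_ _≟_ (shift d (own k a b)) t)

GoodFlip : (a b b′ b″ x y : Letter) → ℕ × ℕ → Set
GoodFlip a b b′ b″ x y t =
  T (ok a x) × T (ok x y) × T (ok y b″) ×
  Added a b a x 0 t × Added b b′ x y 1 t × Added b′ b″ y b″ 2 t

goodFlip? : ∀ a b b′ b″ x y t → Dec (GoodFlip a b b′ b″ x y t)
goodFlip? a b b′ b″ x y t =
  T? (ok a x) ×-dec T? (ok x y) ×-dec T? (ok y b″) ×-dec
  added? a b a x 0 t ×-dec added? b b′ x y 1 t ×-dec added? b′ b″ y b″ 2 t

T-not : ∀ {x} → T x → T (not x) → ⊥
T-not {true} _ ()

owner : Letter → Word → ℕ → Kind → ℕ × ℕ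
owner p f j k = shift j (own k (prev p f j) (f j))

AddsOnly : Letter → Word → Word → ℕ × ℕ → Set
AddsOnly p f f′ t = ∀ j k → T (covers p f′ j k) → T (not (covers p f j k)) → owner p f j k ≡ t

set₂-flip : ∀ p f i x y t → Valid p f →
  GoodFlip (prev p f i) (f i) (f (1 + i)) (f (2 + i)) x y t →
  Valid p (set₂ f i x y) × AddsOnly p f (set₂ f i x y) (shift i t)
set₂-flip p f zero x y t v (h₀ , h₁ , h₂ , h₃ , h₄ , h₅) = valid , adds
  where
  valid : Valid p (set₂ f zero x y)
  valid zero                = h₀
  valid (suc zero)          = h₁
  valid (suc (suc zero))    = h₂
  valid (suc (suc (suc j))) = v (suc (suc (suc j)))
  shift₀ : ∀ t → t ≡ shift 0 t
  shift₀ (s , c) = cong (_, c) (sym (+-identityʳ s))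
  adds : AddsOnly p f (set₂ f zero x y) (shift 0 t)
  adds zero                k h h′ = trans (h₃ k h h′) (shift₀ t)
  adds (suc zero)          k h h′ = trans (h₄ k h h′) (shift₀ t)
  adds (suc (suc zero))    k h h′ = trans (h₅ k h h′) (shift₀ t)
  adds (suc (suc (suc j))) k h h′ = ⊥-elim (T-not h h′)
set₂-flip p f (suc i) x y t v h = valid , adds
  where
  ih = set₂-flip (f 0) (f ∘ suc) i x y t (v ∘ suc) h
  valid : Valid p (set₂ f (suc i) x y)
  valid zero    = v zero
  valid (suc j) = proj₁ ih j
  shift-suc : ∀ j t → shift (suc j) t ≡ shift 1 (shift j t)
  shift-suc j (s , c) = cong (_, c) (trans (cong (λ i → s + i) (+-comm 1 j)) (sym (+-assoc s j 1)))
  adds : AddsOnly p f (set₂ f (suc i) x y) (shift (suc i) t)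
  adds zero    k h h′ = ⊥-elim (T-not h h′)
  adds (suc j) k h h′ = trans (shift-suc j _) (trans (cong (shift 1) (proj₂ ih j k h h′)) (sym (shift-suc i t)))

-- The c-th flip of a fragment with letter b followed by b′, as the replacement of both letters.
flip : Letter → Letter → ℕ → Letter × Letter
flip A b′ _  = RR , b′
flip B b′ _  = LL , b′
flip LL b′ 0 = RL , b′
flip LL b′ 1 = LR , b′
flip LL A  _ = B , LL
flip LL b′ _ = B , b′
flip RR b′ 0 = LR , b′
flip RR b′ 1 = RL , b′
flip RR b′ _ = A , b′
flip LR b′ 0 = RR , b′
flip LR b′ _ = LL , b′
flip RL b′ 0 = LL , b′
flip RL b′ _ = RR , b′

isRR : Letter → Bool
isRR RR = true
isRR _  = false

-- The flip 2 of RR after B does not follow the pattern of flip: it replaces B RR by RR A.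
special : Letter → Letter → ℕ → Bool
special a b c = isB a ∧ isRR b ∧ (c ≡ᵇ 2)

wt≤3 : ∀ b → wt b ≤ 3
wt≤3 A  = s≤s z≤n
wt≤3 B  = s≤s z≤n
wt≤3 LL = ≤-refl
wt≤3 RR = ≤-refl
wt≤3 LR = s≤s (s≤s z≤n)
wt≤3 RL = s≤s (s≤s z≤n)

flip-good : ∀ a b b′ b″ c → T (ok a b) → T (ok b b′) → T (ok b′ b″) → T (c <ᵇ wt b) → T (not (special a b c)) →
  GoodFlip a b b′ b″ (proj₁ (flip b b′ c)) (proj₂ (flip b b′ c)) (1 , c)
flip-good a b b′ b″ c ab bb′ b′b″ c<wt ns =
  let ax , a₁ = left a b b′ ab c<wt ns
      xy , a₂ = middle b b′ bb′ c<wt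
      yb , a₃ = right b b′ b″ b′b″ c<wt
  in ax , xy , yb , a₁ , a₂ , a₃
  where
  x y : Letter → Letter → ℕ → Letter
  x b b′ c = proj₁ (flip b b′ c)
  y b b′ c = proj₂ (flip b b′ c)

  Left Middle Right : ℕ → Set
  Left c = ∀ a b b′ → T (ok a b) → T (c <ᵇ wt b) → T (not (special a b c)) →
    T (ok a (x b b′ c)) × Added a b a (x b b′ c) 0 (1 , c)
  Middle c = ∀ b b′ → T (ok b b′) → T (c <ᵇ wt b) →
    T (ok (x b b′ c) (y b b′ c)) × Added b b′ (x b b′ c) (y b b′ c) 1 (1 , c)
  Right c = ∀ b b′ b″ → T (ok b′ b″) → T (c <ᵇ wt b) →
    T (ok (y b b′ c) b″) × Added b′ b″ (y b b′ c) b″ 2 (1 , c)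

  left? : ∀ c → Dec (Left c)
  left? c = ∀letter? λ a → ∀letter? λ b → ∀letter? λ b′ →
    T? (ok a b) →-dec (T? (c <ᵇ wt b) →-dec (T? (not (special a b c)) →-dec
    (T? (ok a (x b b′ c)) ×-dec added? a b a (x b b′ c) 0 (1 , c))))

  middle? : ∀ c → Dec (Middle c)
  middle? c = ∀letter? λ b → ∀letter? λ b′ →
    T? (ok b b′) →-dec (T? (c <ᵇ wt b) →-dec
    (T? (ok (x b b′ c) (y b b′ c)) ×-dec added? b b′ (x b b′ c) (y b b′ c) 1 (1 , c)))

  right? : ∀ c → Dec (Right c)
  right? c = ∀letter? λ b → ∀letter? λ b′ → ∀letter? λ b″ →
    T? (ok b′ b″) →-dec (T? (c <ᵇ wt b) →-dec
    (T? (ok (y b b′ c) b″) ×-dec added? b′ b″ (y b b′ c) b″ 2 (1 , c)))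

  checked : ∀ c → c < 3 → Left c × Middle c × Right c
  checked 0 _ = toWitness {a? = left? 0} tt , toWitness {a? = middle? 0} tt , toWitness {a? = right? 0} tt
  checked 1 _ = toWitness {a? = left? 1} tt , toWitness {a? = middle? 1} tt , toWitness {a? = right? 1} tt
  checked 2 _ = toWitness {a? = left? 2} tt , toWitness {a? = middle? 2} tt , toWitness {a? = right? 2} tt
  checked (suc (suc (suc _))) (s≤s (s≤s (s≤s ())))

  c<3 : c < 3
  c<3 = ≤-trans (<ᵇ⇒< c (wt b) c<wt) (wt≤3 b)

  left = proj₁ (checked c c<3)
  middle = proj₁ (proj₂ (checked c c<3))
  right = proj₂ (proj₂ (checked c c<3))

special-good : ∀ a b″ → GoodFlip a B RR b″ RR A (2 , 2)
special-good = toWitness {a? = ∀letter? λ a → ∀letter? λ b″ → goodFlip? a B RR b″ RR A (2 , 2)} tt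

Supported : ℕ → Word → Set
Supported n f = ∀ j → n ≤ j → f j ≡ RR

set₂-supported : ∀ n f i x y → i < n → y ≡ f (suc i) ⊎ suc i < n → Supported n f → Supported n (set₂ f i x y)
set₂-supported n f zero x y i<n e s zero n≤j = ⊥-elim (<⇒≱ i<n n≤j)
set₂-supported n f zero x y i<n (inj₁ e) s (suc zero) n≤j = trans e (s 1 n≤j)
set₂-supported n f zero x y i<n (inj₂ e) s (suc zero) n≤j = ⊥-elim (<⇒≱ e n≤j)
set₂-supported n f zero x y i<n e s (suc (suc j)) n≤j = s _ n≤j
set₂-supported (suc n) f (suc i) x y (s≤s i<n) e s (suc j) (s≤s n≤j) =
  set₂-supported n (f ∘ suc) i x y i<n (e′ e) (λ j n≤j → s (suc j) (s≤s n≤j)) j n≤j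
  where
  e′ : y ≡ f (suc (suc i)) ⊎ suc (suc i) < suc n → y ≡ f (suc (suc i)) ⊎ suc i < n
  e′ (inj₁ p) = inj₁ p
  e′ (inj₂ (s≤s p)) = inj₂ p

IsWord : ℕ → Word → Set
IsWord n f = Valid RR f × Supported n f

flip-second : ∀ b b′ c → proj₂ (flip b b′ c) ≡ b′ ⊎ b′ ≡ A
flip-second A  b′ c             = inj₁ refl
flip-second B  b′ c             = inj₁ refl
flip-second LL b′ 0             = inj₁ refl
flip-second LL b′ 1             = inj₁ refl
flip-second LL A  (suc (suc c)) = inj₂ refl
flip-second LL B  (suc (suc c)) = inj₁ refl
flip-second LL LL (suc (suc c)) = inj₁ refl
flip-second LL RR (suc (suc c)) = inj₁ refl
flip-second LL LR (suc (suc c)) = inj₁ refl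
flip-second LL RL (suc (suc c)) = inj₁ refl
flip-second RR b′ 0             = inj₁ refl
flip-second RR b′ 1             = inj₁ refl
flip-second RR b′ (suc (suc c)) = inj₁ refl
flip-second LR b′ 0             = inj₁ refl
flip-second LR b′ (suc c)       = inj₁ refl
flip-second RL b′ 0             = inj₁ refl
flip-second RL b′ (suc c)       = inj₁ refl

ok-suc : ∀ {p f} → Valid p f → ∀ j → T (ok (f j) (f (suc j)))
ok-suc {p} {f} v j = subst (λ a → T (ok a (f (suc j)))) (prev-suc p f j) (v (suc j))

special-elim : ∀ a b c → special a b c ≡ true → a ≡ B × b ≡ RR × c ≡ 2
special-elim B RR c e = refl , refl , ≡ᵇ⇒≡ c 2 (subst T (sym e) tt)

set₂-at : ∀ f i x y → set₂ f i x y i ≡ x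
set₂-at f zero    x y = refl
set₂-at f (suc i) x y = set₂-at (f ∘ suc) i x y

flip-first : ∀ b b′ c → ¬ proj₁ (flip b b′ c) ≡ b
flip-first A  b′ c             ()
flip-first B  b′ c             ()
flip-first LL b′ 0             ()
flip-first LL b′ 1             ()
flip-first LL A  (suc (suc c)) ()
flip-first LL B  (suc (suc c)) ()
flip-first LL LL (suc (suc c)) ()
flip-first LL RR (suc (suc c)) ()
flip-first LL LR (suc (suc c)) ()
flip-first LL RL (suc (suc c)) ()
flip-first RR b′ 0             ()
flip-first RR b′ 1             ()
flip-first RR b′ (suc (suc c)) ()
flip-first LR b′ 0             ()
flip-first LR b′ (suc c)       ()
flip-first RL b′ 0             ()
flip-first RL b′ (suc c)       ()

flipped : ∀ n f i c → IsWord n f → i < n → c < wt (f i) →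
  ∃ λ f′ → IsWord n f′ × AddsOnly RR f f′ (suc i , c) × ∃ λ j → j < n × ¬ f′ j ≡ f j
flipped n f i c (v , s) i<n c<wt with special (prev RR f i) (f i) c in eq
... | false = set₂ f i x y , (proj₁ fl , set₂-supported n f i x y i<n y-ok s) , proj₂ fl , i , i<n ,
  λ e → flip-first (f i) (f (suc i)) c (trans (sym (set₂-at f i x y)) e)
  where
  x = proj₁ (flip (f i) (f (suc i)) c)
  y = proj₂ (flip (f i) (f (suc i)) c)
  fl = set₂-flip RR f i x y (1 , c) v (flip-good (prev RR f i) (f i) (f (1 + i)) (f (2 + i)) c
         (v i) (ok-suc v i) (ok-suc v (suc i)) (<⇒<ᵇ c<wt) (subst (T ∘ not) (sym eq) tt))
  y-ok : y ≡ f (suc i) ⊎ suc i < n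
  y-ok with flip-second (f i) (f (suc i)) c | suc i <? n
  ... | inj₁ e | _ = inj₁ e
  ... | inj₂ e | yes i<n = inj₂ i<n
  ... | inj₂ e | no  i≮n with () ← trans (sym e) (s (suc i) (≮⇒≥ i≮n))
flipped n f zero    c (v , s) i<n c<wt | true with () ← proj₁ (special-elim RR (f 0) c eq)
flipped n f (suc i) c (v , s) i<n c<wt | true
  with pB , pRR , refl ← special-elim (prev RR f (suc i)) (f (suc i)) c eq =
  set₂ f i RR A , (proj₁ fl , set₂-supported n f i RR A (<-trans (n<1+n i) i<n) (inj₂ i<n) s) , proj₂ fl ,
  i , <-trans (n<1+n i) i<n , λ e → RR≢B (trans (sym (set₂-at f i RR A)) (trans e fB))
  where
  RR≢B : ¬ RR ≡ B
  RR≢B ()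
  fB : f i ≡ B
  fB = trans (sym (prev-suc RR f i)) pB
  good : GoodFlip (prev RR f i) (f i) (f (suc i)) (f (suc (suc i))) RR A (2 , 2)
  good rewrite fB | pRR = special-good (prev RR f i) (f (suc (suc i)))
  fl = set₂-flip RR f i RR A (2 , 2) v good

-- A minimum anti-forcing set: the letters other than A and B are forced locally, then A by
-- induction from the left and B from the right.
blockers : ℕ → Letter → List (ℕ × Kind)
blockers i A  = (i , post) ∷ []
blockers i B  = (suc i , post) ∷ []
blockers i LL = (i , up₃) ∷ (i , down₃) ∷ (i , mid) ∷ []
blockers i RR = (i , up₁) ∷ (i , down₁) ∷ (i , mid) ∷ []
blockers i LR = (i , up₃) ∷ (i , down₁) ∷ []
blockers i RL = (i , up₁) ∷ (i , down₃) ∷ []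

length-blockers : ∀ i b → length (blockers i b) ≡ wt b
length-blockers i A = refl
length-blockers i B = refl
length-blockers i LL = refl
length-blockers i RR = refl
length-blockers i LR = refl
length-blockers i RL = refl

Avoids : Word → ℕ × Kind → Set
Avoids f (j , k) = covers RR f j k ≡ false

blockers-avoid : ∀ f i → All (Avoids f) (blockers i (f i))
blockers-avoid f i with f i in eq
... | A = post-A ∷ []
  where
  post-A : covers RR f i post ≡ false
  post-A rewrite eq with isB (prev RR f i)
  ... | true = refl
  ... | false = refl
... | B = post-B ∷ []
  where
  post-B : covers RR f (suc i) post ≡ false
  post-B rewrite prev-suc RR f i | eq = refl
... | LL = cong (not ∘ upLeft) eq ∷ cong (not ∘ downLeft) eq ∷ cong midUsed eq ∷ []
... | RR = cong upLeft eq ∷ cong downLeft eq ∷ cong midUsed eq ∷ []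
... | LR = cong (not ∘ upLeft) eq ∷ cong downLeft eq ∷ []
... | RL = cong upLeft eq ∷ cong (not ∘ downLeft) eq ∷ []

-- In a perfect matching containing mid, the upper and lower hexagons are on the same side; the
-- other two values at true are junk.
decode : Bool → Bool → Bool → Letter
decode true  true  true  = B
decode true  true  false = LL
decode true  false true  = RR
decode true  false false = LR
decode false true  true  = RR
decode false true  false = RL
decode false false true  = A
decode false false false = RR

decode-letter : ∀ b → b ≡ decode (upLeft b) (downLeft b) (midUsed b)
decode-letter A = refl
decode-letter B = refl
decode-letter LL = refl
decode-letter RR = refl
decode-letter LR = refl
decode-letter RL = refl

not-false : ∀ {x} → not x ≡ false → x ≡ true
not-false {true} _ = refl

decode-≡ : ∀ b {u d m} → upLeft b ≡ u → downLeft b ≡ d → midUsed b ≡ m → b ≡ decode u d m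
decode-≡ b refl refl refl = decode-letter b

isA-elim : ∀ {b} → isA b ≡ true → b ≡ A
isA-elim {A} _ = refl

isB-elim : ∀ {b} → isB b ≡ true → b ≡ B
isB-elim {B} _ = refl

decode-mixed : ∀ b {u} → upLeft b ≡ u → downLeft b ≡ not u → b ≡ decode u (not u) false
decode-mixed LR refl refl = refl
decode-mixed RL refl refl = refl

post-unused : ∀ a b → used post a b ≡ false → isB a ≡ true ⊎ isA b ≡ true
post-unused a b e with isB a | isA b
... | true  | _    = inj₁ refl
... | false | true = inj₂ refl

module _ {n : ℕ} {f f′ : Word} (w : IsWord n f) (w′ : IsWord n f′)
         (avoid : ∀ i → i < n → All (Avoids f′) (blockers i (f i))) where

  private
    data View (i : ℕ) : Set where
      A-view : f i ≡ A → i < n → View i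
      B-view : f i ≡ B → i < n → View i
      fixed  : f′ i ≡ f i → isA (f i) ≡ false → isB (f i) ≡ false → View i

    view : ∀ i → View i
    view i with i <? n
    ... | no i≮n = fixed (trans (proj₂ w′ i (≮⇒≥ i≮n)) (sym eq)) (cong isA eq) (cong isB eq)
      where
      eq = proj₂ w i (≮⇒≥ i≮n)
    ... | yes i<n with f i in eq | avoid i i<n
    ...   | A  | _ = A-view eq i<n
    ...   | B  | _ = B-view eq i<n
    ...   | LL | u ∷ d ∷ m ∷ [] = fixed (trans (decode-≡ (f′ i) (not-false u) (not-false d) m) (sym eq)) (cong isA eq) (cong isB eq)
    ...   | RR | u ∷ d ∷ m ∷ [] = fixed (trans (decode-≡ (f′ i) u d m) (sym eq)) (cong isA eq) (cong isB eq)
    ...   | LR | u ∷ d ∷ []     = fixed (trans (decode-mixed (f′ i) (not-false u) d) (sym eq)) (cong isA eq) (cong isB eq)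
    ...   | RL | u ∷ d ∷ []     = fixed (trans (decode-mixed (f′ i) u (not-false d)) (sym eq)) (cong isA eq) (cong isB eq)

    post-A : ∀ i → f i ≡ A → i < n → isB (prev RR f′ i) ≡ true ⊎ isA (f′ i) ≡ true
    post-A i e i<n with avoid i i<n
    ... | av rewrite e with h ∷ [] ← av = post-unused _ _ h

    post-B : ∀ i → f i ≡ B → i < n → isB (f′ i) ≡ true ⊎ isA (f′ (suc i)) ≡ true
    post-B i e i<n with avoid i i<n
    ... | av rewrite e with h ∷ [] ← av | post-unused _ _ h
    ...   | inj₁ b = inj₁ (trans (cong isB (sym (prev-suc RR f′ i))) b)
    ...   | inj₂ a = inj₂ a

    ¬BA : ∀ i → f i ≡ B → ¬ f (suc i) ≡ A
    ¬BA i b a with h ← ok-suc (proj₁ w) i rewrite b | a = h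

    force-A : ∀ i → i < n → f i ≡ A → f′ i ≡ A
    force-A zero i<n e with inj₂ a ← post-A 0 e i<n = isA-elim a
    force-A (suc i) i<n e with post-A (suc i) e i<n
    ... | inj₂ a = isA-elim a
    ... | inj₁ b rewrite prev-suc RR f′ i with view i
    ...   | A-view e′ i<n′ with () ← trans (sym b) (cong isB (force-A i i<n′ e′))
    ...   | B-view e′ _ = ⊥-elim (¬BA i e′ e)
    ...   | fixed e′ _ nb with () ← trans (sym b) (trans (cong isB e′) nb)

    force-B : ∀ d i → i < n → n ≤ d + i → f i ≡ B → f′ i ≡ B
    force-B zero    i i<n n≤ e = ⊥-elim (<⇒≱ i<n n≤)
    force-B (suc d) i i<n n≤ e with post-B i e i<n
    ... | inj₁ b = isB-elim b
    ... | inj₂ a with view (suc i)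
    ...   | A-view e′ _ = ⊥-elim (¬BA i e e′)
    ...   | B-view e′ i<n′ with () ← trans (sym a) (cong isA (force-B d (suc i) i<n′ (≤-trans n≤ (≤-reflexive (sym (+-suc d i)))) e′))
    ...   | fixed e′ na _ with () ← trans (sym a) (trans (cong isA e′) na)

  blockers-force : ∀ i → f′ i ≡ f i
  blockers-force i with view i
  ... | A-view e i<n = trans (force-A i i<n e) (sym e)
  ... | B-view e i<n = trans (force-B n i i<n (m≤m+n n i) e) (sym e)
  ... | fixed e _ _  = e

-- Perfect matchings of a row of fragments

Site : Set
Site = Fin 4 × ℕ

_≟ˢ_ : DecidableEquality Site
_≟ˢ_ = ≡-dec _≟ᶠ_ _≟_

end₁ end₂ : Kind → Site
end₁ top₁  = # 1 , 3
end₁ top₂  = # 2 , 3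
end₁ up₁   = # 1 , 2
end₁ up₃   = # 3 , 2
end₁ hi₀   = # 0 , 2
end₁ hi₁   = # 1 , 2
end₁ hi₂   = # 2 , 2
end₁ hi₃   = # 3 , 2
end₁ post  = # 0 , 1
end₁ mid   = # 2 , 1
end₁ lo₀   = # 0 , 1
end₁ lo₁   = # 1 , 1
end₁ lo₂   = # 2 , 1
end₁ lo₃   = # 3 , 1
end₁ down₁ = # 1 , 0
end₁ down₃ = # 3 , 0
end₁ bot₁  = # 1 , 0
end₁ bot₂  = # 2 , 0
end₂ top₁  = # 2 , 3
end₂ top₂  = # 3 , 3
end₂ up₁   = # 1 , 3
end₂ up₃   = # 3 , 3
end₂ hi₀   = # 1 , 2
end₂ hi₁   = # 2 , 2
end₂ hi₂   = # 3 , 2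
end₂ hi₃   = # 0 , 2
end₂ post  = # 0 , 2
end₂ mid   = # 2 , 2
end₂ lo₀   = # 1 , 1
end₂ lo₁   = # 2 , 1
end₂ lo₂   = # 3 , 1
end₂ lo₃   = # 0 , 1
end₂ down₁ = # 1 , 1
end₂ down₃ = # 3 , 1
end₂ bot₁  = # 2 , 0
end₂ bot₂  = # 3 , 0

jump : Kind → ℕ
jump hi₃ = 1
jump lo₃ = 1
jump _   = 0

MeetsHere MeetsBefore : Site → Kind → Set
MeetsHere a k = end₁ k ≡ a ⊎ (end₂ k ≡ a × jump k ≡ 0)
MeetsBefore a k = end₂ k ≡ a × jump k ≡ 1

meetsHere? : ∀ a k → Dec (MeetsHere a k)
meetsHere? a k = (end₁ k ≟ˢ a) ⊎-dec ((end₂ k ≟ˢ a) ×-dec (jump k ≟ 0))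

meetsBefore? : ∀ a k → Dec (MeetsBefore a k)
meetsBefore? a k = (end₂ k ≟ˢ a) ×-dec (jump k ≟ 1)

before : ℕ → List Kind → List (ℕ × Kind)
before i       []       = []
before zero    (k ∷ ks) = []
before (suc i) (k ∷ ks) = (i , k) ∷ before (suc i) ks

-- The edges at a site, computed so that the stars of concrete sites unfold to lists of edges.
star : ℕ → Site → List (ℕ × Kind)
star i a = map (i ,_) (filter (meetsHere? a) kinds) ++ before i (filter (meetsBefore? a) kinds)

none one : List Bool → Bool
none []          = true
none (true ∷ _)  = false
none (false ∷ xs) = none xs
one []           = false
one (true ∷ xs)  = none xs
one (false ∷ xs) = one xs

columnSites innerSites : List Site
columnSites = (# 0 , 1) ∷ (# 0 , 2) ∷ []
innerSites =
  (# 1 , 0) ∷ (# 2 , 0) ∷ (# 3 , 0) ∷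
  (# 1 , 1) ∷ (# 2 , 1) ∷ (# 3 , 1) ∷
  (# 1 , 2) ∷ (# 2 , 2) ∷ (# 3 , 2) ∷
  (# 1 , 3) ∷ (# 2 , 3) ∷ (# 3 , 3) ∷ []

Saturates : (ℕ → Kind → Bool) → ℕ → Site → Set
Saturates χ i a = one (map (λ (j , k) → χ j k) (star i a)) ≡ true

data IsEdge (n : ℕ) : ℕ → Kind → Set where
  within : ∀ {j k} → j < n → IsEdge n j k
  last   : IsEdge n n post

record Perfect (n : ℕ) (χ : ℕ → Kind → Bool) : Set where
  field
    absent : ∀ {j k} → ¬ IsEdge n j k → χ j k ≡ false
    inner  : ∀ {i} → i < n → All (Saturates χ i) innerSites
    column : ∀ {i} → i ≤ n → All (Saturates χ i) columnSites

ends-alternate : ∀ u₁ t₁ t₂ u₃ → one (t₁ ∷ u₁ ∷ []) ≡ true → one (t₁ ∷ t₂ ∷ []) ≡ true →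
  one (t₂ ∷ u₃ ∷ []) ≡ true → t₁ ≡ not u₁ × t₂ ≡ u₁ × u₃ ≡ not u₁
ends-alternate true  false true  false _ _ _ = refl , refl , refl
ends-alternate false true  false true  _ _ _ = refl , refl , refl

zigzag-forced : ∀ u h₀ h₁ h₂ h₃ m → one (u ∷ h₀ ∷ h₁ ∷ []) ≡ true → one (h₁ ∷ h₂ ∷ m ∷ []) ≡ true →
  one (not u ∷ h₂ ∷ h₃ ∷ []) ≡ true →
  h₀ ≡ m ∧ not u × h₁ ≡ not m ∧ not u × h₂ ≡ not m ∧ u × h₃ ≡ m ∧ u
zigzag-forced true  false false true  false false _ _ _ = refl , refl , refl , refl
zigzag-forced true  false false false true  true  _ _ _ = refl , refl , refl , refl
zigzag-forced false true  false false false true  _ _ _ = refl , refl , refl , refl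
zigzag-forced false false true  false false false _ _ _ = refl , refl , refl , refl

module FromPerfect {n : ℕ} {χ : ℕ → Kind → Bool} (perfect : Perfect n χ) where
  open Perfect perfect

  word : Word
  word i = decode (χ i up₁) (χ i down₁) (χ i mid)

  prevχ : ℕ → Kind → Bool
  prevχ zero    k = false
  prevχ (suc i) k = χ i k

  three : ∀ {x y} → one (x ∷ y ∷ []) ≡ true → one (x ∷ y ∷ false ∷ []) ≡ true
  three {true}  {false} _ = refl
  three {false} {true}  _ = refl

  columns : ∀ {i} → i ≤ n → one (χ i hi₀ ∷ χ i post ∷ prevχ i hi₃ ∷ []) ≡ true ×
                            one (χ i lo₀ ∷ χ i post ∷ prevχ i lo₃ ∷ []) ≡ true
  columns {zero}  i≤n with l ∷ h ∷ [] ← column i≤n = three {χ 0 hi₀} h , three {χ 0 lo₀} l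
  columns {suc i} i≤n with l ∷ h ∷ [] ← column i≤n = h , l

  record Shape (i : ℕ) : Set where
    constructor shape
    field
      top₁≡ : χ i top₁ ≡ not (χ i up₁)
      top₂≡ : χ i top₂ ≡ χ i up₁
      up₃≡  : χ i up₃ ≡ not (χ i up₁)
      hi₀≡  : χ i hi₀ ≡ χ i mid ∧ not (χ i up₁)
      hi₁≡  : χ i hi₁ ≡ not (χ i mid) ∧ not (χ i up₁)
      hi₂≡  : χ i hi₂ ≡ not (χ i mid) ∧ χ i up₁
      hi₃≡  : χ i hi₃ ≡ χ i mid ∧ χ i up₁
      bot₁≡ : χ i bot₁ ≡ not (χ i down₁)
      bot₂≡ : χ i bot₂ ≡ χ i down₁
      down₃≡  : χ i down₃ ≡ not (χ i down₁)
      lo₀≡  : χ i lo₀ ≡ χ i mid ∧ not (χ i down₁)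
      lo₁≡  : χ i lo₁ ≡ not (χ i mid) ∧ not (χ i down₁)
      lo₂≡  : χ i lo₂ ≡ not (χ i mid) ∧ χ i down₁
      lo₃≡  : χ i lo₃ ≡ χ i mid ∧ χ i down₁
  open Shape

  shapeOf : ∀ {i} → i < n → Shape i
  shapeOf {i} i<n
    with b₁ ∷ b₂ ∷ b₃ ∷ l₁ ∷ l₂ ∷ l₃ ∷ h₁ ∷ h₂ ∷ h₃ ∷ t₁ ∷ t₂ ∷ t₃ ∷ [] ← inner i<n
    with et₁ , et₂ , eu ← ends-alternate (χ i up₁) _ _ _ t₁ t₂ t₃
       | eb₁ , eb₂ , ed ← ends-alternate (χ i down₁) _ _ _ b₁ b₂ b₃
    with h₀≡ , h₁≡ , h₂≡ , h₃≡ ← zigzag-forced (χ i up₁) _ _ _ _ _ h₁ h₂ (subst (λ u → one (u ∷ χ i hi₂ ∷ χ i hi₃ ∷ []) ≡ true) eu h₃)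
       | l₀≡ , l₁≡ , l₂≡ , l₃≡ ← zigzag-forced (χ i down₁) _ _ _ _ _ l₁ l₂ (subst (λ u → one (u ∷ χ i lo₂ ∷ χ i lo₃ ∷ []) ≡ true) ed l₃)
    = shape et₁ et₂ eu h₀≡ h₁≡ h₂≡ h₃≡ eb₁ eb₂ ed l₀≡ l₁≡ l₂≡ l₃≡

  one-cancel : ∀ {x x′ y z z′} → z ≡ z′ → one (x ∷ y ∷ z ∷ []) ≡ true → one (x′ ∷ y ∷ z′ ∷ []) ≡ true → x ≡ x′
  one-cancel {true}  {true}  {_}     {_}     refl _ _ = refl
  one-cancel {false} {false} {_}     {_}     refl _ _ = refl
  one-cancel {true}  {false} {false} {false} refl _ ()
  one-cancel {false} {true}  {false} {false} refl () _

  same-side : ∀ {m u d} → m ∧ not u ≡ m ∧ not d → m ∧ u ≡ m ∧ d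
  same-side {false} _ = refl
  same-side {true} {true}  {true}  _ = refl
  same-side {true} {false} {false} _ = refl

  -- By induction from the left, the two long zigzags are matched across each column alike.
  hi₃≡lo₃ : ∀ i → i ≤ n → prevχ i hi₃ ≡ prevχ i lo₃
  hi₀≡lo₀ : ∀ i → i ≤ n → χ i hi₀ ≡ χ i lo₀
  hi₃≡lo₃ zero    _   = refl
  hi₃≡lo₃ (suc i) i<n = trans (hi₃≡ s) (trans (same-side {χ i mid}
    (trans (sym (hi₀≡ s)) (trans (hi₀≡lo₀ i (<⇒≤ i<n)) (lo₀≡ s)))) (sym (lo₃≡ s)))
    where
    s = shapeOf i<n
  hi₀≡lo₀ i i≤n = one-cancel (hi₃≡lo₃ i i≤n) (proj₁ (columns i≤n)) (proj₂ (columns i≤n))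

  decode-spec : ∀ u d m → m ∧ u ≡ m ∧ d → let b = decode u d m in
    upLeft b ≡ u × downLeft b ≡ d × midUsed b ≡ m × isA b ≡ m ∧ not u × isB b ≡ m ∧ u
  decode-spec true  true  true  _ = refl , refl , refl , refl , refl
  decode-spec true  true  false _ = refl , refl , refl , refl , refl
  decode-spec true  false false _ = refl , refl , refl , refl , refl
  decode-spec false true  false _ = refl , refl , refl , refl , refl
  decode-spec false false true  _ = refl , refl , refl , refl , refl
  decode-spec false false false _ = refl , refl , refl , refl , refl

  consistent : ∀ {i} → i < n → χ i mid ∧ χ i up₁ ≡ χ i mid ∧ χ i down₁
  consistent {i} i<n = trans (sym (hi₃≡ s)) (trans (hi₃≡lo₃ (suc i) i<n) (lo₃≡ s))
    where
    s = shapeOf i<n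

  absent-beyond : ∀ {i k} → n ≤ i → ¬ k ≡ post → χ i k ≡ false
  absent-beyond n≤i k≢post = absent λ where
    (within i<n) → <⇒≱ i<n n≤i
    last         → k≢post refl

  word-supported : Supported n word
  word-supported i n≤i rewrite absent-beyond {k = up₁} n≤i (λ ()) | absent-beyond {k = down₁} n≤i (λ ()) | absent-beyond {k = mid} n≤i (λ ()) = refl

  isB-word : ∀ i → i ≤ n → isB (prev RR word i) ≡ prevχ i hi₃
  isB-word zero    _   = refl
  isB-word (suc i) i<n rewrite prev-suc RR word i =
    trans (proj₂ (proj₂ (proj₂ (proj₂ (decode-spec (χ i up₁) (χ i down₁) (χ i mid) (consistent i<n)))))) (sym (hi₃≡ (shapeOf i<n)))

  isA-word : ∀ i → i ≤ n → isA (word i) ≡ χ i hi₀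
  isA-word i i≤n with i <? n
  ... | yes i<n = trans (proj₁ (proj₂ (proj₂ (proj₂ (decode-spec (χ i up₁) (χ i down₁) (χ i mid) (consistent i<n)))))) (sym (hi₀≡ (shapeOf i<n)))
  ... | no i≮n  = trans (cong isA (word-supported i (≮⇒≥ i≮n))) (sym (absent-beyond (≮⇒≥ i≮n) (λ ())))

  post-forced : ∀ {x y z} → one (x ∷ y ∷ z ∷ []) ≡ true → y ≡ not z ∧ not x × T (not (z ∧ x))
  post-forced {true}  {false} {false} _ = refl , tt
  post-forced {false} {true}  {false} _ = refl , tt
  post-forced {false} {false} {true}  _ = refl , tt

  post-word : ∀ i → i ≤ n → χ i post ≡ covers RR word i post
  post-word i i≤n rewrite isB-word i i≤n | isA-word i i≤n = proj₁ (post-forced {χ i hi₀} (proj₁ (columns i≤n)))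

  word-valid : Valid RR word
  word-valid i with i ≤? n
  ... | yes i≤n rewrite isB-word i i≤n | isA-word i i≤n = proj₂ (post-forced {χ i hi₀} (proj₁ (columns i≤n)))
  ... | no  i≰n rewrite word-supported i (<⇒≤ (≰⇒> i≰n)) with isB (prev RR word i)
  ...   | true  = tt
  ...   | false = tt

  isWord : IsWord n word
  isWord = word-valid , word-supported

  covers-word : ∀ {i k} → IsEdge n i k → χ i k ≡ covers RR word i k
  covers-word last = post-word n ≤-refl
  covers-word {i} {k} (within i<n)
    with s ← shapeOf i<n | eu , ed , em , eA , eB ← decode-spec (χ i up₁) (χ i down₁) (χ i mid) (consistent i<n) = go k
    where
    go : ∀ k → χ i k ≡ covers RR word i k
    go top₁ rewrite eu = top₁≡ s
    go top₂ rewrite eu = top₂≡ s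
    go up₁ = sym eu
    go up₃ rewrite eu = up₃≡ s
    go hi₀ = sym (isA-word i (<⇒≤ i<n))
    go hi₁ rewrite eu | em = hi₁≡ s
    go hi₂ rewrite eu | em = hi₂≡ s
    go hi₃ rewrite eB = hi₃≡ s
    go bot₁ rewrite ed = bot₁≡ s
    go bot₂ rewrite ed = bot₂≡ s
    go down₁ = sym ed
    go down₃ rewrite ed = down₃≡ s
    go lo₀ = trans (sym (hi₀≡lo₀ i (<⇒≤ i<n))) (sym (isA-word i (<⇒≤ i<n)))
    go lo₁ rewrite ed | em = lo₁≡ s
    go lo₂ rewrite ed | em = lo₂≡ s
    go lo₃ rewrite eB = trans (sym (hi₃≡lo₃ (suc i) i<n)) (hi₃≡ s)
    go mid = sym em
    go post = post-word i (<⇒≤ i<n)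

module ToPerfect {n : ℕ} {f : Word} {χ : ℕ → Kind → Bool} (w : IsWord n f) (absent : ∀ {j k} → ¬ IsEdge n j k → χ j k ≡ false)
                 (present : ∀ {j k} → IsEdge n j k → χ j k ≡ covers RR f j k) where

  private
    one-cong₂ : ∀ {x x′ y y′} → x ≡ x′ → y ≡ y′ → one (x′ ∷ y′ ∷ []) ≡ true → one (x ∷ y ∷ []) ≡ true
    one-cong₂ refl refl h = h

    one-cong₃ : ∀ {x x′ y y′ z z′} → x ≡ x′ → y ≡ y′ → z ≡ z′ →
                one (x′ ∷ y′ ∷ z′ ∷ []) ≡ true → one (x ∷ y ∷ z ∷ []) ≡ true
    one-cong₃ refl refl refl h = h

  inner-saturated : ∀ {i} → i < n → All (Saturates χ i) innerSites
  inner-saturated {i} i<n =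
    one-cong₂ (e bot₁) (e down₁) (flip-one d) ∷
    one-cong₂ (e bot₁) (e bot₂) (flip-one d) ∷
    one-cong₂ (e bot₂) (e down₃) (one-flip d) ∷
    one-cong₃ (e down₁) (e lo₀) (e lo₁) (first-down (f i)) ∷
    one-cong₃ (e lo₁) (e lo₂) (e mid) (second d m) ∷
    one-cong₃ (e down₃) (e lo₂) (e lo₃) (third-down (f i)) ∷
    one-cong₃ (e up₁) (e hi₀) (e hi₁) (first-up (f i)) ∷
    one-cong₃ (e hi₁) (e hi₂) (e mid) (second u m) ∷
    one-cong₃ (e up₃) (e hi₂) (e hi₃) (third-up (f i)) ∷
    one-cong₂ (e top₁) (e up₁) (flip-one u) ∷
    one-cong₂ (e top₁) (e top₂) (flip-one u) ∷
    one-cong₂ (e top₂) (e up₃) (one-flip u) ∷ []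
    where
    e : ∀ k → χ i k ≡ covers RR f i k
    e k = present (within i<n)
    u = upLeft (f i)
    d = downLeft (f i)
    m = midUsed (f i)
    one-flip : ∀ x → one (x ∷ not x ∷ []) ≡ true
    one-flip true  = refl
    one-flip false = refl
    flip-one : ∀ x → one (not x ∷ x ∷ []) ≡ true
    flip-one true  = refl
    flip-one false = refl
    second : ∀ x m → one (not m ∧ not x ∷ not m ∧ x ∷ m ∷ []) ≡ true
    second x     true  = refl
    second true  false = refl
    second false false = refl
    first-up : ∀ b → one (upLeft b ∷ isA b ∷ not (midUsed b) ∧ not (upLeft b) ∷ []) ≡ true
    first-up = toWitness {a? = ∀letter? λ b → _ ≟ᵇ true} tt
    third-up : ∀ b → one (not (upLeft b) ∷ not (midUsed b) ∧ upLeft b ∷ isB b ∷ []) ≡ true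
    third-up = toWitness {a? = ∀letter? λ b → _ ≟ᵇ true} tt
    first-down : ∀ b → one (downLeft b ∷ isA b ∷ not (midUsed b) ∧ not (downLeft b) ∷ []) ≡ true
    first-down = toWitness {a? = ∀letter? λ b → _ ≟ᵇ true} tt
    third-down : ∀ b → one (not (downLeft b) ∷ not (midUsed b) ∧ downLeft b ∷ isB b ∷ []) ≡ true
    third-down = toWitness {a? = ∀letter? λ b → _ ≟ᵇ true} tt

  one-post : ∀ x y → T (not (y ∧ x)) → one (x ∷ (not y ∧ not x) ∷ y ∷ []) ≡ true
  one-post true  false _ = refl
  one-post false true  _ = refl
  one-post false false _ = refl

  one-post₀ : ∀ x → one (x ∷ not x ∷ []) ≡ true
  one-post₀ true  = refl
  one-post₀ false = refl

  private
    absent-isA : ∀ {i k} → i ≤ n → ¬ k ≡ post → covers RR f i k ≡ isA (f i) → χ i k ≡ isA (f i)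
    absent-isA {i} i≤n k≢post e with i <? n
    ... | yes i<n = trans (present (within i<n)) e
    ... | no  i≮n = trans (absent λ where
      (within i<n) → i≮n i<n
      last         → k≢post refl) (sym (cong isA (proj₂ w i (≮⇒≥ i≮n))))

    present-post : ∀ {i} → i ≤ n → χ i post ≡ covers RR f i post
    present-post i≤n with m≤n⇒m<n∨m≡n i≤n
    ... | inj₁ i<n  = present (within i<n)
    ... | inj₂ refl = present last

  column-saturated : ∀ {i} → i ≤ n → All (Saturates χ i) columnSites
  column-saturated {zero} i≤n =
    one-cong₂ (absent-isA {k = lo₀} i≤n (λ ()) refl) (present-post i≤n) (one-post₀ (isA (f 0))) ∷
    one-cong₂ (absent-isA {k = hi₀} i≤n (λ ()) refl) (present-post i≤n) (one-post₀ (isA (f 0))) ∷ []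
  column-saturated {suc i} i<n =
    one-cong₃ (absent-isA {k = lo₀} i<n (λ ()) refl) post≡ (present {k = lo₃} (within i<n)) h ∷
    one-cong₃ (absent-isA {k = hi₀} i<n (λ ()) refl) post≡ (present {k = hi₃} (within i<n)) h ∷ []
    where
    post≡ : χ (suc i) post ≡ not (isB (f i)) ∧ not (isA (f (suc i)))
    post≡ = trans (present-post i<n) (cong (λ a → used post a (f (suc i))) (prev-suc RR f i))
    h = one-post (isA (f (suc i))) (isB (f i)) (ok-suc (proj₁ w) i)

  perfect : Perfect n χ
  perfect = record { absent = absent ; inner = inner-saturated ; column = column-saturated }

-- The graph H n

place : ℕ × Site → Point
place (i , r , y) = toℕ r + i * 4 , y

first second : ℕ × Kind → ℕ × Site
first  (i , k) = i , end₁ k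
second (i , k) = jump k + i , end₂ k

edgeAt : ℕ × Kind → Point × Point
edgeAt e = place (first e) , place (second e)

fragmentEdges : ℕ → List (ℕ × Kind)
fragmentEdges i =
  (i , lo₀) ∷ (i , lo₁) ∷ (i , hi₀) ∷ (i , hi₁) ∷ (i , post) ∷ (i , mid) ∷
  (i , lo₂) ∷ (i , lo₃) ∷ (i , hi₂) ∷ (i , hi₃) ∷ (i , mid) ∷ (suc i , post) ∷
  (i , hi₁) ∷ (i , hi₂) ∷ (i , top₁) ∷ (i , top₂) ∷ (i , up₁) ∷ (i , up₃) ∷
  (i , bot₁) ∷ (i , bot₂) ∷ (i , lo₁) ∷ (i , lo₂) ∷ (i , down₁) ∷ (i , down₃) ∷ []

fragmentSites : ℕ → List (ℕ × Site)
fragmentSites i =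
  (i , # 0 , 1) ∷ (i , # 1 , 1) ∷ (i , # 2 , 1) ∷ (i , # 0 , 2) ∷ (i , # 1 , 2) ∷ (i , # 2 , 2) ∷
  (i , # 2 , 1) ∷ (i , # 3 , 1) ∷ (suc i , # 0 , 1) ∷ (i , # 2 , 2) ∷ (i , # 3 , 2) ∷ (suc i , # 0 , 2) ∷
  (i , # 1 , 2) ∷ (i , # 2 , 2) ∷ (i , # 3 , 2) ∷ (i , # 1 , 3) ∷ (i , # 2 , 3) ∷ (i , # 3 , 3) ∷
  (i , # 1 , 0) ∷ (i , # 2 , 0) ∷ (i , # 3 , 0) ∷ (i , # 1 , 1) ∷ (i , # 2 , 1) ∷ (i , # 3 , 1) ∷ []

pyreneAt : ℕ → List Point
pyreneAt x = (x , 1) ∷ (2 + x , 1) ∷ (1 + x , 2) ∷ (1 + x , 0) ∷ []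

fragment-edges : ∀ i → concatMap hexagonEdges (pyreneFragment i) ≡ map edgeAt (fragmentEdges i)
fragment-edges i = cong (concatMap hexagonEdges ∘ pyreneAt) (*-comm 4 i)

fragment-sites : ∀ i → concatMap hexagonVertices (pyreneFragment i) ≡ map place (fragmentSites i)
fragment-sites i = cong (concatMap hexagonVertices ∘ pyreneAt) (*-comm 4 i)

∈-fragmentEdges : ∀ i k → (i , k) ∈ fragmentEdges i
∈-fragmentEdges i top₁  = ∈-lookup (# 14)
∈-fragmentEdges i top₂  = ∈-lookup (# 15)
∈-fragmentEdges i bot₁  = ∈-lookup (# 18)
∈-fragmentEdges i bot₂  = ∈-lookup (# 19)
∈-fragmentEdges i up₁   = ∈-lookup (# 16)
∈-fragmentEdges i up₃   = ∈-lookup (# 17)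
∈-fragmentEdges i down₁ = ∈-lookup (# 22)
∈-fragmentEdges i down₃ = ∈-lookup (# 23)
∈-fragmentEdges i hi₀   = ∈-lookup (# 2)
∈-fragmentEdges i hi₁   = ∈-lookup (# 3)
∈-fragmentEdges i hi₂   = ∈-lookup (# 8)
∈-fragmentEdges i hi₃   = ∈-lookup (# 9)
∈-fragmentEdges i lo₀   = ∈-lookup (# 0)
∈-fragmentEdges i lo₁   = ∈-lookup (# 1)
∈-fragmentEdges i lo₂   = ∈-lookup (# 6)
∈-fragmentEdges i lo₃   = ∈-lookup (# 7)
∈-fragmentEdges i mid   = ∈-lookup (# 5)
∈-fragmentEdges i post  = ∈-lookup (# 4)

last∈fragmentEdges : ∀ i → (suc i , post) ∈ fragmentEdges i
last∈fragmentEdges i = ∈-lookup (# 11)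

inner∈fragmentSites : ∀ i → All (λ a → (i , a) ∈ fragmentSites i) innerSites
inner∈fragmentSites i =
  ∈-lookup (# 18) ∷ ∈-lookup (# 19) ∷ ∈-lookup (# 20) ∷
  ∈-lookup (# 1) ∷ ∈-lookup (# 2) ∷ ∈-lookup (# 7) ∷
  ∈-lookup (# 4) ∷ ∈-lookup (# 5) ∷ ∈-lookup (# 10) ∷
  ∈-lookup (# 15) ∷ ∈-lookup (# 16) ∷ ∈-lookup (# 17) ∷ []

column∈fragmentSites : ∀ i → All (λ a → (i , a) ∈ fragmentSites i) columnSites
column∈fragmentSites i = ∈-lookup (# 0) ∷ ∈-lookup (# 3) ∷ []

next∈fragmentSites : ∀ i → All (λ a → (suc i , a) ∈ fragmentSites i) columnSites
next∈fragmentSites i = ∈-lookup (# 8) ∷ ∈-lookup (# 11) ∷ []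

data IsSite (n : ℕ) : ℕ × Site → Set where
  innerSite  : ∀ {i a} → i < n → a ∈ innerSites → IsSite n (i , a)
  columnSite : ∀ {i a} → i ≤ n → a ∈ columnSites → IsSite n (i , a)

fragmentSites-sound : ∀ {n i} → i < n → All (IsSite n) (fragmentSites i)
fragmentSites-sound i<n =
  columnSite (<⇒≤ i<n) (∈-lookup (# 0)) ∷ innerSite i<n (∈-lookup (# 3)) ∷ innerSite i<n (∈-lookup (# 4)) ∷
  columnSite (<⇒≤ i<n) (∈-lookup (# 1)) ∷ innerSite i<n (∈-lookup (# 6)) ∷ innerSite i<n (∈-lookup (# 7)) ∷
  innerSite i<n (∈-lookup (# 4)) ∷ innerSite i<n (∈-lookup (# 5)) ∷ columnSite i<n (∈-lookup (# 0)) ∷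
  innerSite i<n (∈-lookup (# 7)) ∷ innerSite i<n (∈-lookup (# 8)) ∷ columnSite i<n (∈-lookup (# 1)) ∷
  innerSite i<n (∈-lookup (# 6)) ∷ innerSite i<n (∈-lookup (# 7)) ∷ innerSite i<n (∈-lookup (# 8)) ∷
  innerSite i<n (∈-lookup (# 9)) ∷ innerSite i<n (∈-lookup (# 10)) ∷ innerSite i<n (∈-lookup (# 11)) ∷
  innerSite i<n (∈-lookup (# 0)) ∷ innerSite i<n (∈-lookup (# 1)) ∷ innerSite i<n (∈-lookup (# 2)) ∷
  innerSite i<n (∈-lookup (# 3)) ∷ innerSite i<n (∈-lookup (# 4)) ∷ innerSite i<n (∈-lookup (# 5)) ∷ []

next-isEdge : ∀ {n i} → i < n → IsEdge n (suc i) post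
next-isEdge i<n with m≤n⇒m<n∨m≡n i<n
... | inj₁ i<n′ = within i<n′
... | inj₂ refl = last

fragmentEdges-sound : ∀ {n i} → i < n → All (uncurry (IsEdge n)) (fragmentEdges i)
fragmentEdges-sound i<n =
  within i<n ∷ within i<n ∷ within i<n ∷ within i<n ∷ within i<n ∷ within i<n ∷
  within i<n ∷ within i<n ∷ within i<n ∷ within i<n ∷ within i<n ∷ next-isEdge i<n ∷
  within i<n ∷ within i<n ∷ within i<n ∷ within i<n ∷ within i<n ∷ within i<n ∷
  within i<n ∷ within i<n ∷ within i<n ∷ within i<n ∷ within i<n ∷ within i<n ∷ []

hexagons : ℕ → List Point
hexagons n = concatMap pyreneFragment (upTo n)

module _ {X : Set} (f : Point → List X) (code : ℕ → List X) (f≡code : ∀ i → concatMap f (pyreneFragment i) ≡ code i) where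

  ∈-hexagons⁺ : ∀ {n i x} → i < n → x ∈ code i → x ∈ concatMap f (hexagons n)
  ∈-hexagons⁺ {n} {i} i<n x∈ with h , h∈ , x∈h ← find (∈-concatMap⁻ f {xs = pyreneFragment i} (subst (_ ∈_) (sym (f≡code i)) x∈))
    = ∈-concatMap⁺ f (lose (∈-concatMap⁺ pyreneFragment (lose (∈-upTo⁺ i<n) h∈)) x∈h)

  ∈-hexagons⁻ : ∀ {n x} → x ∈ concatMap f (hexagons n) → ∃ λ i → i < n × x ∈ code i
  ∈-hexagons⁻ {n} x∈
    with h , h∈ , x∈h ← find (∈-concatMap⁻ f {xs = hexagons n} x∈)
    with i , i∈ , h∈i ← find (∈-concatMap⁻ pyreneFragment {xs = upTo n} h∈)
    = i , ∈-upTo⁻ i∈ , subst (_ ∈_) (f≡code i) (∈-concatMap⁺ f (lose h∈i x∈h))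

place-injective : ∀ {u v} → place u ≡ place v → u ≡ v
place-injective {i , r , y} {j , s , z} e with ex , refl ← ,-injective e =
  cong₂ _,_ i≡j (cong (_, y) (toℕ-injective r≡s))
  where
  mod : ∀ (r : Fin 4) i → (toℕ r + i * 4) % 4 ≡ toℕ r
  mod r i = trans ([m+kn]%n≡m%n (toℕ r) i 4) (m<n⇒m%n≡m (toℕ<n r))
  r≡s : toℕ r ≡ toℕ s
  r≡s = trans (sym (mod r i)) (trans (cong (_% 4) ex) (mod s j))
  i≡j : i ≡ j
  i≡j = *-cancelʳ-≡ i j 4 (+-cancelˡ-≡ (toℕ r) _ _ (trans ex (cong (_+ j * 4) (sym r≡s))))

ends : Kind → Site × Site
ends k = end₁ k , end₂ k

_≟ᵉ_ : DecidableEquality (Site × Site)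
_≟ᵉ_ = ≡-dec _≟ˢ_ _≟ˢ_

kinds-unique : Unique kinds
kinds-unique = Unique.map⁻ {f = ends} (toWitness {a? = DecUnique.unique? _≟ᵉ_ (map ends kinds)} tt)

withEnds : Site × Site → List Kind
withEnds ab = filter (λ k → ends k ≟ᵉ ab) kinds

withEnds-ends : ∀ k → withEnds (ends k) ≡ k ∷ []
withEnds-ends k = All.lookup {P = λ k → withEnds (ends k) ≡ k ∷ []}
  (refl ∷ refl ∷ refl ∷ refl ∷ refl ∷ refl ∷ refl ∷ refl ∷ refl ∷ refl ∷ refl ∷ refl ∷ refl ∷ refl ∷ refl ∷ refl ∷ refl ∷ refl ∷  []) (∈-kinds k)

ends-injective : ∀ {k l} → ends k ≡ ends l → k ≡ l
ends-injective {k} {l} e = ∷-injectiveˡ (trans (sym (withEnds-ends k)) (trans (cong withEnds e) (withEnds-ends l)))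

edgeAt-injective : ∀ {e e′} → edgeAt e ≡ edgeAt e′ → e ≡ e′
edgeAt-injective {i , k} {j , l} eq with e₁ , e₂ ← ,-injective eq
  with i≡j , k₁ ← ,-injective (place-injective {first (i , k)} {first (j , l)} e₁)
     | _ , k₂ ← ,-injective (place-injective {second (i , k)} {second (j , l)} e₂)
  = cong₂ _,_ i≡j (ends-injective (cong₂ _,_ k₁ k₂))

∈-before⁺ : ∀ {i k ks} → k ∈ ks → (i , k) ∈ before (suc i) ks
∈-before⁺ (here refl) = here refl
∈-before⁺ (there k∈)  = there (∈-before⁺ k∈)

∈-before⁻ : ∀ {i j k} ks → (j , k) ∈ before i ks → suc j ≡ i × k ∈ ks
∈-before⁻ {suc i} (k ∷ ks) (here refl) = refl , here refl
∈-before⁻ {suc i} (_ ∷ ks) (there k∈) with e , k∈ ← ∈-before⁻ ks k∈ = e , there k∈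

before-unique : ∀ i {ks} → Unique ks → Unique (before i ks)
before-unique i       {[]}     []        = []
before-unique zero    {k ∷ ks} (_ ∷ _)   = []
before-unique (suc i) {k ∷ ks} (k∉ ∷ u) =
  All.tabulate (λ {e} e∈ eq → All.lookup k∉ (proj₂ (∈-before⁻ ks (subst (_∈ _) (sym eq) e∈))) refl) ∷ before-unique (suc i) u

star-unique : ∀ i a → Unique (star i a)
star-unique i a = Unique.++⁺ (Unique.map⁺ (λ { refl → refl }) (Unique.filter⁺ (meetsHere? a) kinds-unique))
  (before-unique i (Unique.filter⁺ (meetsBefore? a) kinds-unique)) disjoint
  where
  disjoint : ∀ {e} → e ∈ map (i ,_) (filter (meetsHere? a) kinds) × e ∈ before i (filter (meetsBefore? a) kinds) → ⊥
  disjoint (e∈ , e∈′) with _ , _ , refl ← ∈-map⁻ (i ,_) e∈ = 1+n≢n (proj₁ (∈-before⁻ (filter (meetsBefore? a) kinds) e∈′))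

_touches_ : ℕ × Kind → ℕ × Site → Set
e touches v = v ≡ first e ⊎ v ≡ second e

jump-cases : ∀ k → jump k ≡ 0 ⊎ jump k ≡ 1
jump-cases k with jump k | All.lookup {P = λ k → jump k ≤ 1} (z≤n ∷ z≤n ∷ z≤n ∷ z≤n ∷ z≤n ∷ z≤n ∷ z≤n ∷ z≤n ∷ z≤n ∷ z≤n ∷ z≤n ∷ s≤s z≤n ∷ z≤n ∷ z≤n ∷ z≤n ∷ s≤s z≤n ∷ z≤n ∷ z≤n ∷ []) (∈-kinds k)
... | 0 | _ = inj₁ refl
... | 1 | _ = inj₂ refl
... | suc (suc _) | s≤s ()

∈-star⁺ : ∀ {e i a} → e touches (i , a) → e ∈ star i a
∈-star⁺ {j , k} (inj₁ refl) = ∈-++⁺ˡ (∈-map⁺ _ (∈-filter⁺ (meetsHere? _) (∈-kinds k) (inj₁ refl)))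
∈-star⁺ {j , k} (inj₂ refl) with jump-cases k
... | inj₁ e = subst (λ d → (j , k) ∈ star (d + j) (end₂ k)) (sym e)
  (∈-++⁺ˡ (∈-map⁺ _ (∈-filter⁺ (meetsHere? _) (∈-kinds k) (inj₂ (refl , e)))))
... | inj₂ e = subst (λ d → (j , k) ∈ star (d + j) (end₂ k)) (sym e)
  (∈-++⁺ʳ (map (suc j ,_) (filter (meetsHere? (end₂ k)) kinds))
    (∈-before⁺ (∈-filter⁺ (meetsBefore? _) (∈-kinds k) (refl , e))))

∈-star⁻ : ∀ {e i a} → e ∈ star i a → e touches (i , a)
∈-star⁻ {i = i} {a} e∈ with ∈-++⁻ (map (i ,_) (filter (meetsHere? a) kinds)) e∈
... | inj₁ e∈ˡ with k , k∈ , refl ← ∈-map⁻ (i ,_) e∈ˡ with proj₂ (∈-filter⁻ (meetsHere? a) {xs = kinds} k∈)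
...   | inj₁ refl       = inj₁ refl
...   | inj₂ (refl , e) = inj₂ (cong (λ d → d + i , end₂ k) (sym e))
∈-star⁻ {j , k} {a = a} _ | inj₂ e∈ʳ with refl , k∈ ← ∈-before⁻ (filter (meetsBefore? a) kinds) e∈ʳ
  with refl , e ← proj₂ (∈-filter⁻ (meetsBefore? a) {xs = kinds} k∈) = inj₂ (cong (λ d → d + j , end₂ k) (sym e))

module _ {X : Set} (P : X → Bool) where

  none-intro : ∀ {xs} → (∀ {x} → x ∈ xs → ¬ P x ≡ true) → none (map P xs) ≡ true
  none-intro {[]}     h = refl
  none-intro {x ∷ xs} h with P x in eq
  ... | true  = ⊥-elim (h (here refl) eq)
  ... | false = none-intro (h ∘ there)

  none-elim : ∀ {xs x} → none (map P xs) ≡ true → x ∈ xs → ¬ P x ≡ true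
  none-elim {y ∷ xs} h (here refl) e rewrite e with () ← h
  none-elim {y ∷ xs} h (there x∈) e with P y
  ... | false = none-elim h x∈ e

  one-intro : ∀ {xs x} → Unique xs → x ∈ xs → P x ≡ true → (∀ {y} → y ∈ xs → P y ≡ true → x ≡ y) → one (map P xs) ≡ true
  one-intro {y ∷ xs} (y∉ ∷ u) (here refl) px h rewrite px =
    none-intro λ z∈ pz → All.lookup y∉ z∈ (h (there z∈) pz)
  one-intro {y ∷ xs} (y∉ ∷ u) (there x∈) px h with P y in eq
  ... | true  = ⊥-elim (All.lookup y∉ x∈ (sym (h (here refl) eq)))
  ... | false = one-intro u x∈ px (h ∘ there)

  one-elim : ∀ {xs} → one (map P xs) ≡ true →
    ∃ λ x → x ∈ xs × P x ≡ true × (∀ {y} → y ∈ xs → P y ≡ true → x ≡ y)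
  one-elim {x ∷ xs} h with P x in eq
  ... | true  = x , here refl , eq , only
    where
    only : ∀ {y} → y ∈ x ∷ xs → P y ≡ true → x ≡ y
    only (here refl) _  = refl
    only (there y∈)  py = ⊥-elim (none-elim h y∈ py)
  ... | false with z , z∈ , pz , uniq ← one-elim {xs} h = z , there z∈ , pz , only
    where
    only : ∀ {y} → y ∈ x ∷ xs → P y ≡ true → z ≡ y
    only (here refl) px with () ← trans (sym px) eq
    only (there y∈)  py = uniq y∈ py

lookup-injective : ∀ {X : Set} {xs : List X} → Unique xs → ∀ {i j} → lookup xs i ≡ lookup xs j → i ≡ j
lookup-injective (_ ∷ _) {fzero}  {fzero}  _ = refl
lookup-injective (x∉ ∷ _) {fzero}  {fsuc j} e = ⊥-elim (All.lookup x∉ (∈-lookup j) e)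
lookup-injective (x∉ ∷ _) {fsuc i} {fzero}  e = ⊥-elim (All.lookup x∉ (∈-lookup i) (sym e))
lookup-injective (_ ∷ u) {fsuc i} {fsuc j} e = cong fsuc (lookup-injective u e)

isEdge? : ∀ n j k → Dec (IsEdge n j k)
isEdge? n j k with j <? n
... | yes j<n = yes (within j<n)
... | no  j≮n with j ≟ n | ends k ≟ᵉ ends post
...   | no j≢n   | _     = no λ where
  (within j<n) → j≮n j<n
  last         → j≢n refl
...   | yes refl | yes e with refl ← ends-injective {k} {post} e = yes last
...   | yes refl | no ¬e = no λ where
  (within j<n) → j≮n j<n
  last         → ¬e refl

module _ {hs : List Point} where
  open Graph (hexagonalSystem hs)

  ∈-edges⁻ : ∀ {p} → p ∈ edges → p ∈ concatMap hexagonEdges hs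
  ∈-edges⁻ = ∈-deduplicate⁻ _ (concatMap hexagonEdges hs)

  ∈-edges⁺ : ∀ {p} → p ∈ concatMap hexagonEdges hs → p ∈ edges
  ∈-edges⁺ = ∈-deduplicate⁺ _

  ∈-vertices⁻ : ∀ {p} → p ∈ vertices → p ∈ concatMap hexagonVertices hs
  ∈-vertices⁻ = ∈-deduplicate⁻ _ (concatMap hexagonVertices hs)

  ∈-vertices⁺ : ∀ {p} → p ∈ concatMap hexagonVertices hs → p ∈ vertices
  ∈-vertices⁺ = ∈-deduplicate⁺ _

∈-map-All : ∀ {X Y : Set} {P : X → Set} {f : X → Y} {xs y} → All P xs → y ∈ map f xs → ∃ λ x → P x × y ≡ f x
∈-map-All ps y∈ with x , x∈ , eq ← ∈-map⁻ _ y∈ = x , All.lookup ps x∈ , eq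

hexagonEdge-code : ∀ {n p} → p ∈ concatMap hexagonEdges (hexagons n) → ∃ λ c → uncurry (IsEdge n) c × p ≡ edgeAt c
hexagonEdge-code p∈ =
  let i , i<n , q∈ = ∈-hexagons⁻ hexagonEdges (map edgeAt ∘ fragmentEdges) fragment-edges p∈
  in ∈-map-All (fragmentEdges-sound i<n) q∈

hexagonVertex-site : ∀ {n p} → p ∈ concatMap hexagonVertices (hexagons n) → ∃ λ v → IsSite n v × p ≡ place v
hexagonVertex-site p∈ =
  let i , i<n , q∈ = ∈-hexagons⁻ hexagonVertices (map place ∘ fragmentSites) fragment-sites p∈
  in ∈-map-All (fragmentSites-sound i<n) q∈

-- The lists of vertices and edges of H n are only known through these fields, since unfolding
-- them makes type checking intractable.
record PyreneGraph (n : ℕ) : Set where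
  field
    vertices       : List Point
    edges          : List (Point × Point)
    edges-unique   : Unique edges
    edges⊆vertices : All (λ (u , v) → u ∈ vertices × v ∈ vertices) edges
    edge-code      : ∀ {p} → p ∈ edges → ∃ λ c → uncurry (IsEdge n) c × p ≡ edgeAt c
    edgeAt∈edges   : ∀ {c} → uncurry (IsEdge n) c → edgeAt c ∈ edges
    vertex-site    : ∀ {p} → p ∈ vertices → ∃ λ v → IsSite n v × p ≡ place v
    site∈vertices  : ∀ {v} → IsSite n v → place v ∈ vertices

  graph : Graph
  graph = record
    { Vertex         = Point
    ; _≟_            = _≟ᵖ_
    ; vertices       = vertices
    ; edges          = edges
    ; edges-unique   = edges-unique
    ; edges⊆vertices = edges⊆vertices
    }

pyrene : ∀ n-1 → PyreneGraph (suc n-1)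
pyrene n-1 = record
  { vertices       = Graph.vertices (H n)
  ; edges          = Graph.edges (H n)
  ; edges-unique   = Graph.edges-unique (H n)
  ; edges⊆vertices = Graph.edges⊆vertices (H n)
  ; edge-code      = λ p∈ → hexagonEdge-code (∈-edges⁻ {hexagons n} p∈)
  ; edgeAt∈edges   = λ ie → ∈-edges⁺ {hexagons n} (edge∈ ie)
  ; vertex-site    = λ p∈ → hexagonVertex-site (∈-vertices⁻ {hexagons n} p∈)
  ; site∈vertices  = λ is → ∈-vertices⁺ {hexagons n} (site∈ is)
  }
  where
  n = suc n-1

  edge∈ : ∀ {c} → uncurry (IsEdge n) c → edgeAt c ∈ concatMap hexagonEdges (hexagons n)
  edge∈ {j , k} (within j<n) = ∈-hexagons⁺ hexagonEdges _ fragment-edges j<n (∈-map⁺ edgeAt (∈-fragmentEdges j k))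
  edge∈ last                 = ∈-hexagons⁺ hexagonEdges _ fragment-edges (n<1+n n-1) (∈-map⁺ edgeAt (last∈fragmentEdges n-1))

  fragmentSite∈ : ∀ {i v} → i < n → v ∈ fragmentSites i → place v ∈ concatMap hexagonVertices (hexagons n)
  fragmentSite∈ i<n v∈ = ∈-hexagons⁺ hexagonVertices _ fragment-sites i<n (∈-map⁺ place v∈)

  site∈ : ∀ {v} → IsSite n v → place v ∈ concatMap hexagonVertices (hexagons n)
  site∈ (innerSite i<n a∈) = fragmentSite∈ i<n (All.lookup (inner∈fragmentSites _) a∈)
  site∈ (columnSite i≤n a∈) with m≤n⇒m<n∨m≡n i≤n
  ... | inj₁ i<n  = fragmentSite∈ i<n (All.lookup (column∈fragmentSites _) a∈)
  ... | inj₂ refl = fragmentSite∈ (n<1+n n-1) (All.lookup (next∈fragmentSites n-1) a∈)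

module Coding {n : ℕ} (PG : PyreneGraph n) where

  open PyreneGraph PG
  open Graph graph using (Edge; EdgeSet; _isEndOf_)

  code : Edge → ℕ × Kind
  code e = proj₁ (edge-code (∈-lookup {xs = edges} e))

  code-isEdge : ∀ e → uncurry (IsEdge n) (code e)
  code-isEdge e = proj₁ (proj₂ (edge-code (∈-lookup {xs = edges} e)))

  edgeAt-code : ∀ e → lookup edges e ≡ edgeAt (code e)
  edgeAt-code e = proj₂ (proj₂ (edge-code (∈-lookup {xs = edges} e)))

  index : ∀ {c} → uncurry (IsEdge n) c → Edge
  index ie = Any.index (edgeAt∈edges ie)

  code-index : ∀ {c} (ie : uncurry (IsEdge n) c) → code (index ie) ≡ c
  code-index {c} ie = edgeAt-injective {code (index ie)} {c}
    (trans (sym (edgeAt-code (index ie))) (sym (lookup-index (edgeAt∈edges ie))))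

  code-injective : ∀ {e f} → code e ≡ code f → e ≡ f
  code-injective {e} {f} eq = lookup-injective edges-unique
    (trans (edgeAt-code e) (trans (cong edgeAt eq) (sym (edgeAt-code f))))

  star⇒isEndOf : ∀ i a {e} → code e ∈ star i a → place (i , a) isEndOf e
  star⇒isEndOf i a {e} e∈ with ∈-star⁻ {code e} {i} {a} e∈
  ... | inj₁ eq = inj₁ (trans (cong place eq) (cong proj₁ (sym (edgeAt-code e))))
  ... | inj₂ eq = inj₂ (trans (cong place eq) (cong proj₂ (sym (edgeAt-code e))))

  isEndOf⇒star : ∀ i a {e} → place (i , a) isEndOf e → code e ∈ star i a
  isEndOf⇒star i a {e} (inj₁ eq) = ∈-star⁺ {code e} {i} {a}
    (inj₁ (place-injective {i , a} {first (code e)} (trans eq (cong proj₁ (edgeAt-code e)))))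
  isEndOf⇒star i a {e} (inj₂ eq) = ∈-star⁺ {code e} {i} {a}
    (inj₂ (place-injective {i , a} {second (code e)} (trans eq (cong proj₂ (edgeAt-code e)))))

  χ : EdgeSet → ℕ → Kind → Bool
  χ M j k with isEdge? n j k
  ... | yes ie = Vec.lookup M (index ie)
  ... | no  _  = false

  χ-absent : ∀ M {j k} → ¬ IsEdge n j k → χ M j k ≡ false
  χ-absent M {j} {k} ¬ie with isEdge? n j k
  ... | yes ie = ⊥-elim (¬ie ie)
  ... | no  _  = refl

  χ-code : ∀ M {e j k} → code e ≡ (j , k) → χ M j k ≡ Vec.lookup M e
  χ-code M {e} {j} {k} eq with isEdge? n j k
  ... | yes ie = cong (Vec.lookup M) (code-injective (trans (code-index ie) (sym eq)))
  ... | no ¬ie = ⊥-elim (¬ie (subst (uncurry (IsEdge n)) eq (code-isEdge e)))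

  χ-elim : ∀ M {j k} → χ M j k ≡ true → ∃ λ e → e ∈ˢ M × code e ≡ (j , k)
  χ-elim M {j} {k} h with isEdge? n j k
  ... | yes ie = index ie , Vec.lookup⇒[]= _ M h , code-index ie

  χ-intro : ∀ {M e} → e ∈ˢ M → uncurry (χ M) (code e) ≡ true
  χ-intro {M} e∈ = trans (χ-code M refl) (Vec.[]=⇒lookup e∈)

  Covered : EdgeSet → Point → Set
  Covered M p = ∃! _≡_ (λ e → e ∈ˢ M × p isEndOf e)

  covered⇒saturates : ∀ {M} i a → Covered M (place (i , a)) → Saturates (χ M) i a
  covered⇒saturates {M} i a (e , (e∈ , end) , only) =
    one-intro (uncurry (χ M)) (star-unique i a) (isEndOf⇒star i a end) (χ-intro e∈) unique
    where
    unique : ∀ {c} → c ∈ star i a → uncurry (χ M) c ≡ true → code e ≡ c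
    unique c∈ h with f , f∈ , refl ← χ-elim M h = cong code (only (f∈ , star⇒isEndOf i a c∈))

  saturates⇒covered : ∀ {M} i a → Saturates (χ M) i a → Covered M (place (i , a))
  saturates⇒covered {M} i a h
    with c , c∈ , χc , only ← one-elim (uncurry (χ M)) {star i a} h
    with e , e∈ , refl ← χ-elim M χc
    = e , (e∈ , star⇒isEndOf i a c∈) , λ (f∈ , end) →
      code-injective (only (isEndOf⇒star i a end) (χ-intro f∈))

  covered⇒perfect : ∀ {M} → All (Covered M) vertices → Perfect n (χ M)
  covered⇒perfect {M} cov = record
    { absent = χ-absent M
    ; inner  = λ {i} i<n → All.tabulate λ a∈ → sat (innerSite i<n a∈)
    ; column = λ {i} i≤n → All.tabulate λ a∈ → sat (columnSite i≤n a∈)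
    }
    where
    sat : ∀ {i a} → IsSite n (i , a) → Saturates (χ M) i a
    sat {i} {a} s = covered⇒saturates i a (All.lookup cov (site∈vertices s))

  perfect⇒covered : ∀ {M} → Perfect n (χ M) → All (Covered M) vertices
  perfect⇒covered {M} P = All.tabulate λ p∈ → cov (vertex-site p∈)
    where
    cov : ∀ {p} → (∃ λ v → IsSite n v × p ≡ place v) → Covered M p
    cov (_ , innerSite  {i} {a} i<n a∈ , refl) = saturates⇒covered i a (All.lookup (Perfect.inner P i<n) a∈)
    cov (_ , columnSite {i} {a} i≤n a∈ , refl) = saturates⇒covered i a (All.lookup (Perfect.column P i≤n) a∈)

  matching : Word → EdgeSet
  matching f = Vec.tabulate (uncurry (covers RR f) ∘ code)

  lookup-matching : ∀ f e → Vec.lookup (matching f) e ≡ uncurry (covers RR f) (code e)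
  lookup-matching f e = Vec.lookup∘tabulate _ e

  χ-matching : ∀ f {j k} → IsEdge n j k → χ (matching f) j k ≡ covers RR f j k
  χ-matching f ie = trans (χ-code (matching f) (code-index ie))
    (trans (lookup-matching f (index ie)) (cong (uncurry (covers RR f)) (code-index ie)))

  matching-covered : ∀ {f} → IsWord n f → All (Covered (matching f)) vertices
  matching-covered {f} w = perfect⇒covered (ToPerfect.perfect w (χ-absent (matching f)) (χ-matching f))

  covered-matching : ∀ {M} → All (Covered M) vertices → ∃ λ f → IsWord n f × M ≡ matching f
  covered-matching {M} cov = word , isWord , eq
    where
    open FromPerfect (covered⇒perfect cov)
    eq : M ≡ matching word
    eq = trans (sym (Vec.tabulate∘lookup M)) (Vec.tabulate-cong λ e →
      trans (sym (χ-code M refl)) (covers-word (code-isEdge e)))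

  matching-cong : ∀ {f g} → (∀ i → f i ≡ g i) → matching f ≡ matching g
  matching-cong {f} {g} f≗g = Vec.tabulate-cong λ e → cong₂ (used (proj₂ (code e))) (prev-cong (proj₁ (code e))) (f≗g _)
    where
    prev-cong : ∀ j → prev RR f j ≡ prev RR g j
    prev-cong zero    = refl
    prev-cong (suc j) = trans (prev-suc RR f j) (trans (f≗g j) (sym (prev-suc RR g j)))

  matching-injective : ∀ {f g} → matching f ≡ matching g → ∀ {i} → i < n → f i ≡ g i
  matching-injective {f} {g} eq {i} i<n =
    trans (decode-letter (f i)) (trans (cong₃ decode (at up₁) (at down₁) (at mid)) (sym (decode-letter (g i))))
    where
    at : ∀ k → covers RR f i k ≡ covers RR g i k
    at k = trans (sym (χ-matching f (within i<n))) (trans (cong (λ M → χ M i k) eq) (χ-matching g (within i<n)))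
    cong₃ : ∀ {U V W Z : Set} (h : U → V → W → Z) {a a′ b b′ c c′} → a ≡ a′ → b ≡ b′ → c ≡ c′ → h a b c ≡ h a′ b′ c′
    cong₃ h refl refl refl = refl

-- Anti-forcing numbers

fromList : ∀ {m} → List (Fin m) → Subset m
fromList []       = ∅
fromList (x ∷ xs) = fromList xs [ x ]≔ inside

∣insert∣≤ : ∀ {m} (p : Subset m) x → ∣ p [ x ]≔ inside ∣ ≤ suc ∣ p ∣
∣insert∣≤ (inside  Vec.∷ p) fzero    = n≤1+n _
∣insert∣≤ (outside Vec.∷ p) fzero    = ≤-refl
∣insert∣≤ (inside  Vec.∷ p) (fsuc x) = s≤s (∣insert∣≤ p x)
∣insert∣≤ (outside Vec.∷ p) (fsuc x) = ∣insert∣≤ p x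

∣insert∣≥ : ∀ {m} (p : Subset m) x → x ∉ˢ p → suc ∣ p ∣ ≤ ∣ p [ x ]≔ inside ∣
∣insert∣≥ (inside  Vec.∷ p) fzero    x∉ = ⊥-elim (x∉ here)
∣insert∣≥ (outside Vec.∷ p) fzero    x∉ = ≤-refl
∣insert∣≥ (inside  Vec.∷ p) (fsuc x) x∉ = s≤s (∣insert∣≥ p x (x∉ ∘ there))
∣insert∣≥ (outside Vec.∷ p) (fsuc x) x∉ = ∣insert∣≥ p x (x∉ ∘ there)

∈-fromList⁺ : ∀ {m} {x : Fin m} {xs} → x ∈ xs → x ∈ˢ fromList xs
∈-fromList⁺ {xs = x ∷ xs} (here refl) = Vec.[]≔-updates (fromList xs) x
∈-fromList⁺ {x = x} {xs = y ∷ xs} (there x∈) with x ≟ᶠ y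
... | yes refl = Vec.[]≔-updates (fromList xs) x
... | no x≢y   = Vec.[]≔-minimal (fromList xs) x y x≢y (∈-fromList⁺ x∈)

∈-fromList⁻ : ∀ {m} {x : Fin m} xs → x ∈ˢ fromList xs → x ∈ xs
∈-fromList⁻ []       x∈ = ⊥-elim (∉⊥ x∈)
∈-fromList⁻ {x = x} (y ∷ xs) x∈ with x ≟ᶠ y
... | yes refl = here refl
... | no x≢y   = there (∈-fromList⁻ xs (Vec.lookup⇒[]= x (fromList xs)
  (trans (sym (Vec.lookup∘update′ x≢y (fromList xs) inside)) (Vec.[]=⇒lookup x∈))))

∣fromList∣≤ : ∀ {m} (xs : List (Fin m)) → ∣ fromList xs ∣ ≤ length xs
∣fromList∣≤ {m} []  = ≤-reflexive (∣⊥∣≡0 m)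
∣fromList∣≤ (x ∷ xs) = ≤-trans (∣insert∣≤ (fromList xs) x) (s≤s (∣fromList∣≤ xs))

∣fromList∣≥ : ∀ {m} {xs : List (Fin m)} → Unique xs → length xs ≤ ∣ fromList xs ∣
∣fromList∣≥ []       = z≤n
∣fromList∣≥ {xs = x ∷ xs} (x∉ ∷ u) = ≤-trans (s≤s (∣fromList∣≥ u))
  (∣insert∣≥ (fromList xs) x λ x∈ → All.lookup x∉ (∈-fromList⁻ xs x∈) refl)

image-length≤ : ∀ {m} {Y : Set} {p : Subset m} (g : Fin m → Y) {ys} → Unique ys →
  All (λ y → ∃ λ x → x ∈ˢ p × g x ≡ y) ys → length ys ≤ ∣ p ∣
image-length≤ {m} {Y} {p} g {ys} ys! hs = begin
  length ys           ≡⟨ cong length (image hs) ⟨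
  length (map g xs)   ≡⟨ length-map g xs ⟩
  length xs           ≤⟨ ∣fromList∣≥ (Unique.map⁻ (subst Unique (sym (image hs)) ys!)) ⟩
  ∣ fromList xs ∣     ≤⟨ p⊆q⇒∣p∣≤∣q∣ (λ x∈ → All.lookup (members hs) (∈-fromList⁻ xs x∈)) ⟩
  ∣ p ∣               ∎
  where
  open ≤-Reasoning
  Preimage : Y → Set
  Preimage y = ∃ λ x → x ∈ˢ p × g x ≡ y
  preimages : ∀ {ys} → All Preimage ys → List (Fin m)
  preimages = All.reduce proj₁
  xs : List (Fin m)
  xs = preimages hs
  image : ∀ {ys} (hs : All Preimage ys) → map g (preimages hs) ≡ ys
  image []                  = refl
  image ((_ , _ , eq) ∷ hs) = cong₂ _∷_ eq (image hs)
  members : ∀ {ys} (hs : All Preimage ys) → All (_∈ˢ p) (preimages hs)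
  members []                  = []
  members ((_ , x∈ , _) ∷ hs) = x∈ ∷ members hs

length-concatMap : ∀ {X Y : Set} (f : X → List Y) xs → length (concatMap f xs) ≡ sum (map (length ∘ f) xs)
length-concatMap f []       = refl
length-concatMap f (x ∷ xs) = trans (length-++ (f x)) (cong (λ l → length (f x) + l) (length-concatMap f xs))

concatMap-unique : ∀ {X Y Z : Set} (g : X → Y → Z) → (∀ {x x′ y y′} → g x y ≡ g x′ y′ → x ≡ x′ × y ≡ y′) →
  ∀ {ys : X → List Y} {xs} → (∀ x → Unique (ys x)) → Unique xs → Unique (concatMap (λ x → map (g x) (ys x)) xs)
concatMap-unique g inj ys! [] = []
concatMap-unique g inj {ys} {x ∷ xs} ys! (x∉ ∷ xs!) =
  Unique.++⁺ (Unique.map⁺ (proj₂ ∘ inj) (ys! x)) (concatMap-unique g inj ys! xs!) disjoint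
  where
  disjoint : ∀ {z} → z ∈ map (g x) (ys x) × z ∈ concatMap (λ x → map (g x) (ys x)) xs → ⊥
  disjoint (z∈ , z∈′)
    with y , _ , refl ← ∈-map⁻ (g x) z∈
    with x′ , x′∈ , z∈″ ← find (∈-concatMap⁻ (λ x → map (g x) (ys x)) {xs = xs} z∈′)
    with y′ , _ , eq ← ∈-map⁻ (g x′) z∈″
    = All.lookup x∉ x′∈ (proj₁ (inj eq))

weight : ℕ → Word → ℕ
weight n f = sum (map (wt ∘ f) (upTo n))

slots : ℕ → Word → List (ℕ × ℕ)
slots n f = concatMap (λ i → map (λ c → suc i , c) (upTo (wt (f i)))) (upTo n)

slots-unique : ∀ n f → Unique (slots n f)
slots-unique n f = concatMap-unique (λ i c → suc i , c) (λ { refl → refl , refl }) (λ i → Unique.upTo⁺ _) (Unique.upTo⁺ n)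

sum-map-cong : ∀ {X : Set} {f g : X → ℕ} → (∀ x → f x ≡ g x) → ∀ xs → sum (map f xs) ≡ sum (map g xs)
sum-map-cong f≗g []       = refl
sum-map-cong f≗g (x ∷ xs) = cong₂ _+_ (f≗g x) (sum-map-cong f≗g xs)

length-slots : ∀ n f → length (slots n f) ≡ weight n f
length-slots n f = trans (length-concatMap (λ i → map (λ c → suc i , c) (upTo (wt (f i)))) (upTo n))
  (sum-map-cong (λ i → trans (length-map _ (upTo (wt (f i)))) (length-upTo (wt (f i)))) (upTo n))

allBlockers : ℕ → Word → List (ℕ × Kind)
allBlockers n f = concatMap (λ i → blockers i (f i)) (upTo n)

length-allBlockers : ∀ n f → length (allBlockers n f) ≡ weight n f
length-allBlockers n f = trans (length-concatMap (λ i → blockers i (f i)) (upTo n))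
  (sum-map-cong (λ i → length-blockers i (f i)) (upTo n))

blockers-isEdge : ∀ {n i} → i < n → ∀ b → All (uncurry (IsEdge n)) (blockers i b)
blockers-isEdge i<n A  = within i<n ∷ []
blockers-isEdge i<n B  = next-isEdge i<n ∷ []
blockers-isEdge i<n LL = within i<n ∷ within i<n ∷ within i<n ∷ []
blockers-isEdge i<n RR = within i<n ∷ within i<n ∷ within i<n ∷ []
blockers-isEdge i<n LR = within i<n ∷ within i<n ∷ []
blockers-isEdge i<n RL = within i<n ∷ within i<n ∷ []

allBlockers-All : ∀ {P : ℕ × Kind → Set} n f → (∀ {i} → i < n → All P (blockers i (f i))) → All P (allBlockers n f)
allBlockers-All n f h = All.tabulate λ c∈ →
  let i , i∈ , c∈i = find (∈-concatMap⁻ (λ i → blockers i (f i)) {xs = upTo n} c∈)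
  in All.lookup (h (∈-upTo⁻ i∈)) c∈i

module AntiForcing {n : ℕ} (PG : PyreneGraph n) where

  open PyreneGraph PG
  open Graph graph using (Edge; EdgeSet)
  open Coding PG

  matching-∈ : ∀ {f e} → e ∈ˢ matching f → uncurry (covers RR f) (code e) ≡ true
  matching-∈ {f} {e} e∈ = trans (sym (lookup-matching f e)) (Vec.[]=⇒lookup e∈)

  matching-∉ : ∀ {f e} → e ∉ˢ matching f → uncurry (covers RR f) (code e) ≡ false
  matching-∉ {f} {e} e∉ with uncurry (covers RR f) (code e) in eq
  ... | true  = ⊥-elim (e∉ (Vec.lookup⇒[]= e (matching f) (trans (lookup-matching f e) eq)))
  ... | false = refl

  indices : ∀ {cs} → All (uncurry (IsEdge n)) cs → List Edge
  indices = All.reduce index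

  length-indices : ∀ {cs} (es : All (uncurry (IsEdge n)) cs) → length (indices es) ≡ length cs
  length-indices []       = refl
  length-indices (e ∷ es) = cong suc (length-indices es)

  ∈-indices⁻ : ∀ {cs e} (es : All (uncurry (IsEdge n)) cs) → e ∈ indices es → code e ∈ cs
  ∈-indices⁻ (ie ∷ es) (here refl) = here (code-index ie)
  ∈-indices⁻ (_ ∷ es)  (there e∈)  = there (∈-indices⁻ es e∈)

  ∈-indices⁺ : ∀ {cs c} (es : All (uncurry (IsEdge n)) cs) → c ∈ cs → ∃ λ e → e ∈ indices es × code e ≡ c
  ∈-indices⁺ (ie ∷ es) (here refl) = index ie , here refl , code-index ie
  ∈-indices⁺ (_ ∷ es)  (there c∈) with e , e∈ , eq ← ∈-indices⁺ es c∈ = e , there e∈ , eq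

  module _ {f : Word} (w : IsWord n f) where

    matching-isPerfect : IsPerfectMatching graph (matching f)
    matching-isPerfect = (λ _ → ∈⊤) , matching-covered w

    allBlockers-isEdge : All (uncurry (IsEdge n)) (allBlockers n f)
    allBlockers-isEdge = allBlockers-All n f λ {i} i<n → blockers-isEdge i<n (f i)

    blockerSet : EdgeSet
    blockerSet = fromList (indices allBlockers-isEdge)

    blockerSet-code : ∀ {e} → e ∈ˢ blockerSet → code e ∈ allBlockers n f
    blockerSet-code e∈ = ∈-indices⁻ allBlockers-isEdge (∈-fromList⁻ (indices allBlockers-isEdge) e∈)

    blockerSet-disjoint : ∀ {e} → e ∈ˢ blockerSet → e ∉ˢ matching f
    blockerSet-disjoint e∈ e∈M with () ← trans (sym (matching-∈ {f} e∈M))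
      (All.lookup (allBlockers-All n f λ {i} _ → blockers-avoid f i) (blockerSet-code e∈))

    blockerSet-forces : ∀ M′ → IsPerfectMatchingOf graph (∁ blockerSet) M′ → M′ ≡ matching f
    blockerSet-forces M′ (M′⊆ , cov) with f′ , w′ , refl ← covered-matching cov =
      matching-cong (blockers-force w w′ λ i i<n → All.tabulate λ c∈ → avoids
        (∈-indices⁺ allBlockers-isEdge (∈-concatMap⁺ (λ i → blockers i (f i)) (lose (∈-upTo⁺ i<n) c∈))))
      where
      avoids : ∀ {c} → (∃ λ e → e ∈ indices allBlockers-isEdge × code e ≡ c) → Avoids f′ c
      avoids (e , e∈ , refl) = matching-∉ {f′} λ e∈M → x∈∁p⇒x∉p (M′⊆ e∈M) (∈-fromList⁺ e∈)

    blockerSet-antiForcing : IsAntiForcingSet graph (matching f) blockerSet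
    blockerSet-antiForcing =
      (λ e∈ → x∉p⇒x∈∁p (blockerSet-disjoint e∈)) ,
      ((λ e∈ → x∉p⇒x∈∁p λ e∈S → blockerSet-disjoint e∈S e∈) , matching-covered w) ,
      blockerSet-forces

    af≤weight : af graph (matching f) ≤ weight n f
    af≤weight = begin
      af graph (matching f)                  ≤⟨ af-minimal graph blockerSet-antiForcing ⟩
      ∣ blockerSet ∣                         ≤⟨ ∣fromList∣≤ (indices allBlockers-isEdge) ⟩
      length (indices allBlockers-isEdge)    ≡⟨ length-indices allBlockers-isEdge ⟩
      length (allBlockers n f)               ≡⟨ length-allBlockers n f ⟩
      weight n f                             ∎
      where open ≤-Reasoning

    edgeOwner : Edge → ℕ × ℕ
    edgeOwner e = uncurry (owner RR f) (code e)

    module _ {S : EdgeSet} (anti : IsAntiForcingSet graph (matching f) S) where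

      hit : ∀ {i c} → i < n → c < wt (f i) → ∃ λ e → e ∈ˢ S × edgeOwner e ≡ (suc i , c)
      hit {i} {c} i<n c<wt
        with f′ , w′ , adds , j , j<n , f′≢f ← flipped n f i c w i<n c<wt
        with any? (λ e → (e ∈ˢ? S) ×-dec (e ∈ˢ? matching f′))
      ... | yes (e , e∈S , e∈M′) = e , e∈S , adds (proj₁ (code e)) (proj₂ (code e)) (subst T (sym (matching-∈ {f′} e∈M′)) tt)
              (subst (T ∘ not) (sym (matching-∉ {f} (x∈∁p⇒x∉p (proj₁ anti e∈S)))) tt)
      ... | no disjoint = ⊥-elim (f′≢f (matching-injective
              (proj₂ (proj₂ anti) (matching f′) ((λ {e} e∈ → x∉p⇒x∈∁p λ e∈S → disjoint (e , e∈S , e∈)) , matching-covered w′)) j<n))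

      hits : All (λ s → ∃ λ e → e ∈ˢ S × edgeOwner e ≡ s) (slots n f)
      hits = All.tabulate λ s∈ →
        let i , i∈ , s∈i = find (∈-concatMap⁻ (λ i → map (λ c → suc i , c) (upTo (wt (f i)))) {xs = upTo n} s∈)
            c , c∈ , eq = ∈-map⁻ (λ c → suc i , c) s∈i
            e , e∈ , eq′ = hit (∈-upTo⁻ i∈) (∈-upTo⁻ c∈)
        in e , e∈ , trans eq′ (sym eq)

      weight≤∣S∣ : weight n f ≤ ∣ S ∣
      weight≤∣S∣ = ≤-trans (≤-reflexive (sym (length-slots n f))) (image-length≤ edgeOwner (slots-unique n f) hits)

    af-matching : af graph (matching f) ≡ weight n f
    af-matching = ≤-antisym af≤weight
      (let S , anti , eq = af-attained graph matching-isPerfect in ≤-trans (weight≤∣S∣ anti) (≤-reflexive eq))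

-- Enumeration of the perfect matchings

successors : Letter → List Letter
successors p = filter (λ b → T? (ok p b)) letters

words : Letter → ℕ → List (List Letter)
words p zero    = [] ∷ []
words p (suc n) = concatMap (λ b → map (b ∷_) (words b n)) (successors p)

at : List Letter → Word
at []       _       = RR
at (b ∷ bs) zero    = b
at (b ∷ bs) (suc i) = at bs i

ok-RR : ∀ a → T (ok a RR)
ok-RR a with isB a
... | true  = tt
... | false = tt

∈-words⁻ : ∀ {p n bs} → bs ∈ words p (suc n) → ∃₂ λ b bs′ → bs ≡ b ∷ bs′ × T (ok p b) × bs′ ∈ words b n
∈-words⁻ {p} {n} bs∈
  with b , b∈ , bs∈b ← find (∈-concatMap⁻ (λ b → map (b ∷_) (words b n)) {xs = successors p} bs∈)
  with bs′ , bs′∈ , eq ← ∈-map⁻ (b ∷_) bs∈b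
  = b , bs′ , eq , proj₂ (∈-filter⁻ (λ b → T? (ok p b)) {xs = letters} b∈) , bs′∈

words-valid : ∀ {p} n {bs} → bs ∈ words p n → Valid p (at bs)
words-valid zero    (here refl) j = ok-RR _
words-valid {p} (suc n) bs∈ j with b , bs′ , refl , p-b , bs′∈ ← ∈-words⁻ {p} {n} bs∈ with j
... | zero   = p-b
... | suc j′ = words-valid n bs′∈ j′

words-supported : ∀ {p} n {bs} → bs ∈ words p n → Supported n (at bs)
words-supported zero    (here refl) j _ = refl
words-supported {p} (suc n) bs∈ (suc j) (s≤s n≤j) with b , bs′ , refl , _ , bs′∈ ← ∈-words⁻ {p} {n} bs∈ =
  words-supported n bs′∈ j n≤j

applyUpTo-at : ∀ {p} n {bs} → bs ∈ words p n → applyUpTo (at bs) n ≡ bs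
applyUpTo-at zero    (here refl) = refl
applyUpTo-at {p} (suc n) bs∈ with b , bs′ , refl , _ , bs′∈ ← ∈-words⁻ {p} {n} bs∈ = cong (b ∷_) (applyUpTo-at n bs′∈)

∈-words⁺ : ∀ {p f} n → Valid p f → applyUpTo f n ∈ words p n
∈-words⁺         zero    v = here refl
∈-words⁺ {p} {f} (suc n) v = ∈-concatMap⁺ (λ b → map (b ∷_) (words b n))
  (lose (∈-filter⁺ (λ b → T? (ok p b)) (∈-letters (f 0)) (v 0)) (∈-map⁺ (f 0 ∷_) (∈-words⁺ n (v ∘ suc))))

at-applyUpTo : ∀ n f → Supported n f → ∀ i → at (applyUpTo f n) i ≡ f i
at-applyUpTo zero    f s i       = sym (s i z≤n)
at-applyUpTo (suc n) f s zero    = refl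
at-applyUpTo (suc n) f s (suc i) = at-applyUpTo n (f ∘ suc) (λ j n≤j → s (suc j) (s≤s n≤j)) i

applyUpTo-cong : ∀ {X : Set} {f g : ℕ → X} n → (∀ {i} → i < n → f i ≡ g i) → applyUpTo f n ≡ applyUpTo g n
applyUpTo-cong zero    f≗g = refl
applyUpTo-cong (suc n) f≗g = cong₂ _∷_ (f≗g (s≤s z≤n)) (applyUpTo-cong n (f≗g ∘ s≤s))

successors-unique : ∀ p → Unique (successors p)
successors-unique p = Unique.filter⁺ (λ b → T? (ok p b)) letters-unique
  where
  letters-unique : Unique letters
  letters-unique =
    ((λ ()) ∷ (λ ()) ∷ (λ ()) ∷ (λ ()) ∷ (λ ()) ∷ []) ∷ ((λ ()) ∷ (λ ()) ∷ (λ ()) ∷ (λ ()) ∷ []) ∷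
    ((λ ()) ∷ (λ ()) ∷ (λ ()) ∷ []) ∷ ((λ ()) ∷ (λ ()) ∷ []) ∷ ((λ ()) ∷ []) ∷ [] ∷ []

words-unique : ∀ p n → Unique (words p n)
words-unique p zero    = [] ∷ []
words-unique p (suc n) = concatMap-unique _∷_ ∷-injective (λ b → words-unique b n) (successors-unique p)

map-unique : ∀ {X Y : Set} {g : X → Y} {xs} → (∀ {x y} → x ∈ xs → y ∈ xs → g x ≡ g y → x ≡ y) → Unique xs → Unique (map g xs)
map-unique inj []        = []
map-unique inj (x∉ ∷ u) =
  All.map⁺ (All.tabulate λ y∈ e → All.lookup x∉ y∈ (inj (here refl) (there y∈) e)) ∷
  map-unique (λ x∈ y∈ → inj (there x∈) (there y∈)) u

subsets-unique : ∀ m → Unique (subsets m)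
subsets-unique zero    = [] ∷ []
subsets-unique (suc m) = Unique.++⁺ (Unique.map⁺ Vec.∷-injectiveʳ (subsets-unique m)) (Unique.map⁺ Vec.∷-injectiveʳ (subsets-unique m)) disjoint
  where
  disjoint : ∀ {p} → p ∈ map (inside Vec.∷_) (subsets m) × p ∈ map (outside Vec.∷_) (subsets m) → ⊥
  disjoint (p∈ , p∈′) with _ , _ , refl ← ∈-map⁻ (inside Vec.∷_) p∈ with _ , _ , () ← ∈-map⁻ (outside Vec.∷_) p∈′

module Enumeration {n : ℕ} (PG : PyreneGraph n) where

  open PyreneGraph PG
  open Coding PG
  open AntiForcing PG

  word-isWord : ∀ {bs} → bs ∈ words RR n → IsWord n (at bs)
  word-isWord bs∈ = words-valid n bs∈ , words-supported n bs∈

  perfectMatchings-words : perfectMatchings graph ↭ map (matching ∘ at) (words RR n)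
  perfectMatchings-words = ∼bag⇒↭ (unique∧set⇒bag
    (Unique.filter⁺ (isPerfectMatching? graph) (subsets-unique (length edges)))
    (map-unique injective (words-unique RR n))
    (mk⇔ to from))
    where
    injective : ∀ {bs bs′} → bs ∈ words RR n → bs′ ∈ words RR n → matching (at bs) ≡ matching (at bs′) → bs ≡ bs′
    injective bs∈ bs′∈ eq = trans (sym (applyUpTo-at n bs∈))
      (trans (applyUpTo-cong n (matching-injective eq)) (applyUpTo-at n bs′∈))

    to : ∀ {M} → M ∈ perfectMatchings graph → M ∈ map (matching ∘ at) (words RR n)
    to M∈ with _ , _ , cov ← ∈-filter⁻ (isPerfectMatching? graph) {xs = subsets (length edges)} M∈
      with f , (v , s) , refl ← covered-matching cov
      = subst (_∈ map (matching ∘ at) (words RR n)) (matching-cong (at-applyUpTo n f s)) (∈-map⁺ (matching ∘ at) (∈-words⁺ n v))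

    from : ∀ {M} → M ∈ map (matching ∘ at) (words RR n) → M ∈ perfectMatchings graph
    from M∈ with bs , bs∈ , refl ← ∈-map⁻ (matching ∘ at) M∈ =
      ∈-filter⁺ (isPerfectMatching? graph) (∈-subsets _) (matching-isPerfect (word-isWord bs∈))

  af-word : ∀ {bs} → bs ∈ words RR n → af graph (matching (at bs)) ≡ sum (map wt bs)
  af-word {bs} bs∈ = trans (af-matching (word-isWord bs∈)) (cong sum
    (trans (map-upTo (wt ∘ at bs) n) (trans (sym (map-applyUpTo (at bs) wt n)) (cong (map wt) (applyUpTo-at n bs∈)))))

-- The triple sum

Σ< : ℕ → (ℕ → ℤ) → ℤ
Σ< zero    g = 0ℤ
Σ< (suc m) g = g 0 +ᶻ Σ< m (g ∘ suc)

Σ<-cong : ∀ m {g h} → (∀ {i} → i < m → g i ≡ h i) → Σ< m g ≡ Σ< m h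
Σ<-cong zero    e = refl
Σ<-cong (suc m) e = cong₂ _+ᶻ_ (e (s≤s z≤n)) (Σ<-cong m (e ∘ s≤s))

Σ<-zero : ∀ m {g} → (∀ {i} → i < m → g i ≡ 0ℤ) → Σ< m g ≡ 0ℤ
Σ<-zero zero    e = refl
Σ<-zero (suc m) e = cong₂ _+ᶻ_ (e (s≤s z≤n)) (Σ<-zero m (e ∘ s≤s))

Σ<-+ : ∀ m g h → Σ< m (λ i → g i +ᶻ h i) ≡ Σ< m g +ᶻ Σ< m h
Σ<-+ zero    g h = refl
Σ<-+ (suc m) g h = trans (cong (g 0 +ᶻ h 0 +ᶻ_) (Σ<-+ m (g ∘ suc) (h ∘ suc))) (interchange (g 0) (h 0) _ _)
  where
  interchange : ∀ a b c d → (a +ᶻ b) +ᶻ (c +ᶻ d) ≡ (a +ᶻ c) +ᶻ (b +ᶻ d)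
  interchange = solve-∀

Σ<-* : ∀ m a g → Σ< m (λ i → a *ᶻ g i) ≡ a *ᶻ Σ< m g
Σ<-* zero    a g = sym (ℤ.*-zeroʳ a)
Σ<-* (suc m) a g = trans (cong (a *ᶻ g 0 +ᶻ_) (Σ<-* m a (g ∘ suc))) (sym (ℤ.*-distribˡ-+ a (g 0) _))

Σ<-last : ∀ m g → Σ< (suc m) g ≡ Σ< m g +ᶻ g m
Σ<-last zero    g = ℤ.+-comm (g 0) 0ℤ
Σ<-last (suc m) g = trans (cong (g 0 +ᶻ_) (Σ<-last m (g ∘ suc))) (sym (ℤ.+-assoc (g 0) _ _))

Σ<-from : ∀ a b {g h : ℕ → ℤ} → (∀ {j} → a ≤ j → j < b → g j ≡ h j) → (∀ {j} → j < a → h j ≡ 0ℤ) →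
  Σ< (b ∸ a) (λ j → g (a + j)) ≡ Σ< b h
Σ<-from zero    b       e z = Σ<-cong b (e z≤n)
Σ<-from (suc a) zero    e z = refl
Σ<-from (suc a) (suc b) {g} {h} e z = begin
  Σ< (b ∸ a) (λ j → g (suc a + j)) ≡⟨ Σ<-from a b {g ∘ suc} (λ a≤j j<b → e (s≤s a≤j) (s≤s j<b)) (z ∘ s≤s) ⟩
  Σ< b (h ∘ suc)           ≡⟨ ℤ.+-identityˡ _ ⟨
  0ℤ +ᶻ Σ< b (h ∘ suc)     ≡⟨ cong (_+ᶻ Σ< b (h ∘ suc)) (z (s≤s z≤n)) ⟨
  h 0 +ᶻ Σ< b (h ∘ suc)    ∎
  where open ≡-Reasoning

-- Sequences are power series: X multiplies by x, trinomial by 2 (1 + x + x²).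
X : (ℕ → ℤ) → ℕ → ℤ
X s zero    = 0ℤ
X s (suc k) = s k

X-cong : ∀ {s t} → (∀ k → s k ≡ t k) → ∀ k → X s k ≡ X t k
X-cong e zero    = refl
X-cong e (suc k) = e k

trinomial : (ℕ → ℤ) → ℕ → ℤ
trinomial s k = + 2 *ᶻ (s k +ᶻ X s k +ᶻ X (X s) k)

trinomial-cong : ∀ {s t} → (∀ k → s k ≡ t k) → ∀ k → trinomial s k ≡ trinomial t k
trinomial-cong e k = cong (+ 2 *ᶻ_) (cong₂ _+ᶻ_ (cong₂ _+ᶻ_ (e k) (X-cong e k)) (X-cong (X-cong e) k))

δ : ℕ → ℤ
δ zero    = 1ℤ
δ (suc k) = 0ℤ

chebyshev : ℕ → ℕ → ℤ
chebyshev 0             k = δ k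
chebyshev 1             k = trinomial δ k
chebyshev (suc (suc n)) k = trinomial (chebyshev (suc n)) k -ᶻ chebyshev n k

-- Kept abstract, as the library's _C_ unfolds to a quotient of factorials.
abstract
  binom : ℕ → ℕ → ℤ
  binom n k = + (n C k)

  binom≡ : ∀ n k → binom n k ≡ + (n C k)
  binom≡ n k = refl

  binom-0 : ∀ n → binom n 0 ≡ 1ℤ
  binom-0 n = refl

  binom-> : ∀ {n k} → n < k → binom n k ≡ 0ℤ
  binom-> n<k = cong +_ (k>n⇒nCk≡0 n<k)

  pascal : ∀ n k → binom (suc n) (suc k) ≡ binom n k +ᶻ binom n (suc k)
  pascal n k = cong +_ (sym (nCk+nC[k+1]≡[n+1]C[k+1] n k))

trinomialTerm : ℕ → ℕ → ℕ → ℤ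
trinomialTerm m k j = binom m j *ᶻ binom j (k ∸ j)

trinomialCoeff : ℕ → ℕ → ℤ
trinomialCoeff m k = Σ< (suc k) (trinomialTerm m k)

raised : ℕ → ℕ → ℤ
raised m k = Σ< (suc k) (λ j → binom m j *ᶻ binom (suc j) (k ∸ j))

raised≡ : ∀ m k → raised m k ≡ trinomialCoeff m k +ᶻ X (trinomialCoeff m) k
raised≡ m zero rewrite binom-0 m | binom-0 1 | binom-0 0 = refl
raised≡ m (suc k) = begin
  raised m (suc k)
    ≡⟨ Σ<-last (suc k) (λ j → binom m j *ᶻ binom (suc j) (suc k ∸ j)) ⟩
  Σ< (suc k) (λ j → binom m j *ᶻ binom (suc j) (suc k ∸ j)) +ᶻ binom m (suc k) *ᶻ binom (suc (suc k)) (k ∸ k)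
    ≡⟨ cong₂ _+ᶻ_ (Σ<-cong (suc k) split) (cong (binom m (suc k) *ᶻ_) top) ⟩
  Σ< (suc k) (λ j → trinomialTerm m k j +ᶻ trinomialTerm m (suc k) j) +ᶻ trinomialTerm m (suc k) (suc k)
    ≡⟨ cong (_+ᶻ trinomialTerm m (suc k) (suc k)) (Σ<-+ (suc k) (trinomialTerm m k) (trinomialTerm m (suc k))) ⟩
  trinomialCoeff m k +ᶻ Σ< (suc k) (trinomialTerm m (suc k)) +ᶻ trinomialTerm m (suc k) (suc k)
    ≡⟨ ℤ.+-assoc (trinomialCoeff m k) _ _ ⟩
  trinomialCoeff m k +ᶻ (Σ< (suc k) (trinomialTerm m (suc k)) +ᶻ trinomialTerm m (suc k) (suc k))
    ≡⟨ cong (trinomialCoeff m k +ᶻ_) (Σ<-last (suc k) (trinomialTerm m (suc k))) ⟨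
  trinomialCoeff m k +ᶻ trinomialCoeff m (suc k)
    ≡⟨ ℤ.+-comm (trinomialCoeff m k) _ ⟩
  trinomialCoeff m (suc k) +ᶻ trinomialCoeff m k ∎
  where
  open ≡-Reasoning
  top : binom (suc (suc k)) (k ∸ k) ≡ binom (suc k) (k ∸ k)
  top rewrite n∸n≡0 k = trans (binom-0 (suc (suc k))) (sym (binom-0 (suc k)))
  split : ∀ {j} → j < suc k → binom m j *ᶻ binom (suc j) (suc k ∸ j) ≡ trinomialTerm m k j +ᶻ trinomialTerm m (suc k) j
  split {j} (s≤s j≤k) rewrite +-∸-assoc 1 j≤k | pascal j (k ∸ j) = ℤ.*-distribˡ-+ (binom m j) _ _

trinomialCoeff-suc : ∀ m k → trinomialCoeff (suc m) k ≡
  trinomialCoeff m k +ᶻ X (trinomialCoeff m) k +ᶻ X (X (trinomialCoeff m)) k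
trinomialCoeff-suc m zero rewrite binom-0 (suc m) | binom-0 m | binom-0 0 = refl
trinomialCoeff-suc m (suc k) = begin
  trinomialCoeff (suc m) (suc k)
    ≡⟨ cong₂ (λ c s → c *ᶻ binom 0 (suc k) +ᶻ s) (trans (binom-0 (suc m)) (sym (binom-0 m))) (Σ<-cong (suc k) (λ {j} _ → split j)) ⟩
  trinomialTerm m (suc k) 0 +ᶻ Σ< (suc k) (λ j → binom m j *ᶻ binom (suc j) (k ∸ j) +ᶻ trinomialTerm m (suc k) (suc j))
    ≡⟨ cong (trinomialTerm m (suc k) 0 +ᶻ_) (Σ<-+ (suc k) (λ j → binom m j *ᶻ binom (suc j) (k ∸ j)) (trinomialTerm m (suc k) ∘ suc)) ⟩
  trinomialTerm m (suc k) 0 +ᶻ (raised m k +ᶻ Σ< (suc k) (trinomialTerm m (suc k) ∘ suc))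
    ≡⟨ rearrange (trinomialTerm m (suc k) 0) (raised m k) (Σ< (suc k) (trinomialTerm m (suc k) ∘ suc)) ⟩
  trinomialCoeff m (suc k) +ᶻ raised m k
    ≡⟨ cong (trinomialCoeff m (suc k) +ᶻ_) (raised≡ m k) ⟩
  trinomialCoeff m (suc k) +ᶻ (trinomialCoeff m k +ᶻ X (trinomialCoeff m) k)
    ≡⟨ ℤ.+-assoc (trinomialCoeff m (suc k)) _ _ ⟨
  trinomialCoeff m (suc k) +ᶻ trinomialCoeff m k +ᶻ X (trinomialCoeff m) k ∎
  where
  open ≡-Reasoning
  split : ∀ j → trinomialTerm (suc m) (suc k) (suc j) ≡ binom m j *ᶻ binom (suc j) (k ∸ j) +ᶻ trinomialTerm m (suc k) (suc j)
  split j rewrite pascal m j = ℤ.*-distribʳ-+ (binom (suc j) (k ∸ j)) (binom m j) _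
  rearrange : ∀ a b c → a +ᶻ (b +ᶻ c) ≡ a +ᶻ c +ᶻ b
  rearrange = solve-∀

trinomialCoeff-zero : ∀ k → trinomialCoeff 0 k ≡ δ k
trinomialCoeff-zero zero    rewrite binom-0 0 = refl
trinomialCoeff-zero (suc k) = Σ<-zero (2 + k) term
  where
  term : ∀ {j} → j < 2 + k → trinomialTerm 0 (suc k) j ≡ 0ℤ
  term {zero}  _ rewrite binom-> {0} {suc k} (s≤s z≤n) = ℤ.*-zeroʳ (binom 0 0)
  term {suc j} _ rewrite binom-> {0} {suc j} (s≤s z≤n) = refl

trinomialTerm-vanishes : ∀ m k j → j + j < k → trinomialTerm m k j ≡ 0ℤ
trinomialTerm-vanishes m k j 2j<k = trans (cong (binom m j *ᶻ_) (binom-> j<k∸j)) (ℤ.*-zeroʳ (binom m j))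
  where
  j<k∸j : j < k ∸ j
  j<k∸j = m+n≤o⇒m≤o∸n (suc j) 2j<k

trinomialCoeff-vanishes : ∀ m k → m + m < k → trinomialCoeff m k ≡ 0ℤ
trinomialCoeff-vanishes m k 2m<k = Σ<-zero (suc k) term
  where
  term : ∀ {j} → j < suc k → trinomialTerm m k j ≡ 0ℤ
  term {j} _ with j ≤? m
  ... | yes j≤m = trinomialTerm-vanishes m k j (≤-trans (s≤s (+-mono-≤ j≤m j≤m)) 2m<k)
  ... | no  j≰m = cong (_*ᶻ binom j (k ∸ j)) (binom-> (≰⇒> j≰m))

power : ℕ → ℕ → ℤ
power m k = + (2 ^ m) *ᶻ trinomialCoeff m k

power-suc : ∀ m k → power (suc m) k ≡ trinomial (power m) k
power-suc m k = trans (cong₂ _*ᶻ_ (ℤ.pos-* 2 (2 ^ m)) (trinomialCoeff-suc m k))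
  (trans (scale (+ (2 ^ m)) _ _ _) (cong (+ 2 *ᶻ_) (cong₂ _+ᶻ_ (cong (power m k +ᶻ_) (sym (X-* k))) (sym (trans (X-cong X-* k) (X-*′ k))))))
  where
  scale : ∀ c x y z → + 2 *ᶻ c *ᶻ (x +ᶻ y +ᶻ z) ≡ + 2 *ᶻ (c *ᶻ x +ᶻ c *ᶻ y +ᶻ c *ᶻ z)
  scale = solve-∀
  X-* : ∀ k → X (power m) k ≡ + (2 ^ m) *ᶻ X (trinomialCoeff m) k
  X-* zero    = sym (ℤ.*-zeroʳ (+ (2 ^ m)))
  X-* (suc k) = refl
  X-*′ : ∀ k → X (λ k → + (2 ^ m) *ᶻ X (trinomialCoeff m) k) k ≡ + (2 ^ m) *ᶻ X (X (trinomialCoeff m)) k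
  X-*′ zero    = sym (ℤ.*-zeroʳ (+ (2 ^ m)))
  X-*′ (suc k) = refl

-- U n y is the Chebyshev-like polynomial Σᵢ (−1)ⁿ⁻ⁱ C(i, n − i) y²ⁱ⁻ⁿ, with y m in place of yᵐ.
Uterm : ℕ → (ℕ → ℤ) → ℕ → ℤ
Uterm n y i = (-1ℤ ^ᶻ (n ∸ i)) *ᶻ binom i (n ∸ i) *ᶻ y (2 * i ∸ n)

U : ℕ → (ℕ → ℤ) → ℤ
U n y = Σ< (suc n) (Uterm n y)

U-suc : ∀ n y → U (2 + n) y ≡ U (1 + n) (y ∘ suc) -ᶻ U n y
U-suc n y = begin
  Uterm (2 + n) y 0 +ᶻ Σ< (2 + n) (Uterm (2 + n) y ∘ suc)
    ≡⟨ cong₂ _+ᶻ_ first-term (Σ<-last (suc n) (Uterm (2 + n) y ∘ suc)) ⟩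
  0ℤ +ᶻ (Σ< (suc n) (Uterm (2 + n) y ∘ suc) +ᶻ Uterm (2 + n) y (2 + n))
    ≡⟨ cong₂ (λ a b → 0ℤ +ᶻ (a +ᶻ b)) (trans (Σ<-cong (suc n) split) (Σ<-+ (suc n) (λ i → -1ℤ *ᶻ Uterm n y i) shifted)) last-term ⟩
  0ℤ +ᶻ ((Σ< (suc n) (λ i → -1ℤ *ᶻ Uterm n y i) +ᶻ Σ< (suc n) shifted) +ᶻ shifted (suc n))
    ≡⟨ cong (λ a → 0ℤ +ᶻ ((a +ᶻ Σ< (suc n) shifted) +ᶻ shifted (suc n))) (Σ<-* (suc n) -1ℤ (Uterm n y)) ⟩
  0ℤ +ᶻ ((-1ℤ *ᶻ U n y +ᶻ Σ< (suc n) shifted) +ᶻ shifted (suc n))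
    ≡⟨ rearrange (U n y) _ _ ⟩
  (Σ< (suc n) shifted +ᶻ shifted (suc n)) -ᶻ U n y
    ≡⟨ cong (_-ᶻ U n y) (Σ<-last (suc n) shifted) ⟨
  Σ< (2 + n) shifted -ᶻ U n y
    ≡⟨ cong (_-ᶻ U n y) (Σ<-cong (2 + n) (λ {i} _ → unshift i)) ⟩
  U (1 + n) (y ∘ suc) -ᶻ U n y ∎
  where
  open ≡-Reasoning

  shifted : ℕ → ℤ
  shifted i = (-1ℤ ^ᶻ (1 + n ∸ i)) *ᶻ binom i (1 + n ∸ i) *ᶻ y (2 * i ∸ n)

  2*suc : ∀ i → 2 * suc i ∸ (2 + n) ≡ 2 * i ∸ n
  2*suc i = cong (_∸ (2 + n)) (*-suc 2 i)

  rearrange : ∀ u a b → 0ℤ +ᶻ ((-1ℤ *ᶻ u +ᶻ a) +ᶻ b) ≡ (a +ᶻ b) -ᶻ u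
  rearrange = solve-∀

  vanish : ∀ s {c a} → c ≡ 0ℤ → s *ᶻ c *ᶻ a ≡ 0ℤ
  vanish s refl rewrite ℤ.*-zeroʳ s = refl

  first-term : Uterm (2 + n) y 0 ≡ 0ℤ
  first-term = vanish (-1ℤ ^ᶻ (2 + n)) (binom-> (s≤s z≤n))

  last-term : Uterm (2 + n) y (2 + n) ≡ shifted (suc n)
  last-term rewrite 2*suc (suc n) | n∸n≡0 n | binom-0 (2 + n) | binom-0 (1 + n) = refl

  expand : ∀ s a b z → -1ℤ *ᶻ s *ᶻ (a +ᶻ b) *ᶻ z ≡ -1ℤ *ᶻ (s *ᶻ a *ᶻ z) +ᶻ -1ℤ *ᶻ s *ᶻ b *ᶻ z
  expand = solve-∀

  split : ∀ {i} → i < suc n → Uterm (2 + n) y (suc i) ≡ -1ℤ *ᶻ Uterm n y i +ᶻ shifted i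
  split {i} (s≤s i≤n) rewrite 2*suc i | +-∸-assoc 1 i≤n | pascal i (n ∸ i) =
    expand (-1ℤ ^ᶻ (n ∸ i)) (binom i (n ∸ i)) (binom i (suc (n ∸ i))) (y (2 * i ∸ n))

  unshift : ∀ i → shifted i ≡ Uterm (1 + n) (y ∘ suc) i
  unshift i with suc n ≤? 2 * i
  ... | yes n<2i = cong (λ r → (-1ℤ ^ᶻ (1 + n ∸ i)) *ᶻ binom i (1 + n ∸ i) *ᶻ y r) (+-∸-assoc 1 n<2i)
  ... | no  n≮2i = trans (vanish (-1ℤ ^ᶻ (1 + n ∸ i)) small) (sym (vanish (-1ℤ ^ᶻ (1 + n ∸ i)) small))
    where
    small : binom i (1 + n ∸ i) ≡ 0ℤ
    small = binom-> (m+n≤o⇒m≤o∸n (suc i) (subst (λ j → i + j < suc n) (+-identityʳ i) (≰⇒> n≮2i)))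

Ucoeff : ℕ → ℕ → ℤ
Ucoeff n i = (-1ℤ ^ᶻ (n ∸ i)) *ᶻ binom i (n ∸ i)

U-cong : ∀ n {y z} → (∀ m → y m ≡ z m) → U n y ≡ U n z
U-cong n e = Σ<-cong (suc n) λ {i} _ → cong (Ucoeff n i *ᶻ_) (e (2 * i ∸ n))

U-+ : ∀ n y z → U n (λ m → y m +ᶻ z m) ≡ U n y +ᶻ U n z
U-+ n y z = trans (Σ<-cong (suc n) λ {i} _ → ℤ.*-distribˡ-+ (Ucoeff n i) (y (2 * i ∸ n)) (z (2 * i ∸ n)))
  (Σ<-+ (suc n) (Uterm n y) (Uterm n z))

U-* : ∀ n a y → U n (λ m → a *ᶻ y m) ≡ a *ᶻ U n y
U-* n a y = trans (Σ<-cong (suc n) λ {i} _ → pull (Ucoeff n i) a (y (2 * i ∸ n))) (Σ<-* (suc n) a (Uterm n y))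
  where
  pull : ∀ s a y → s *ᶻ (a *ᶻ y) ≡ a *ᶻ (s *ᶻ y)
  pull = solve-∀

U-0 : ∀ n → U n (λ _ → 0ℤ) ≡ 0ℤ
U-0 n = Σ<-zero (suc n) λ {i} _ → ℤ.*-zeroʳ (Ucoeff n i)

U-X : ∀ n (s : ℕ → ℕ → ℤ) k → U n (λ m → X (s m) k) ≡ X (λ k → U n (λ m → s m k)) k
U-X n s zero    = U-0 n
U-X n s (suc k) = refl

U-trinomial : ∀ n (s : ℕ → ℕ → ℤ) k → U n (λ m → trinomial (s m) k) ≡ trinomial (λ k → U n (λ m → s m k)) k
U-trinomial n s k = begin
  U n (λ m → trinomial (s m) k)
    ≡⟨ U-* n (+ 2) (λ m → s m k +ᶻ X (s m) k +ᶻ X (X (s m)) k) ⟩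
  + 2 *ᶻ U n (λ m → s m k +ᶻ X (s m) k +ᶻ X (X (s m)) k)
    ≡⟨ cong (+ 2 *ᶻ_) (U-+ n (λ m → s m k +ᶻ X (s m) k) (λ m → X (X (s m)) k)) ⟩
  + 2 *ᶻ (U n (λ m → s m k +ᶻ X (s m) k) +ᶻ U n (λ m → X (X (s m)) k))
    ≡⟨ cong (+ 2 *ᶻ_) (cong₂ _+ᶻ_
         (trans (U-+ n (λ m → s m k) (λ m → X (s m) k)) (cong (U n (λ m → s m k) +ᶻ_) (U-X n s k)))
         (trans (U-X n (λ m → X (s m)) k) (X-cong (U-X n s) k))) ⟩
  trinomial (λ k → U n (λ m → s m k)) k ∎
  where open ≡-Reasoning

U-zero : ∀ y → U 0 y ≡ y 0
U-zero y rewrite binom-0 0 = simplify (y 0)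
  where
  simplify : ∀ x → 1ℤ *ᶻ 1ℤ *ᶻ x +ᶻ 0ℤ ≡ x
  simplify = solve-∀

U-one : ∀ y → U 1 y ≡ y 1
U-one y rewrite binom-> {0} {1} (s≤s z≤n) | binom-0 1 = simplify (y 0) (y 1)
  where
  simplify : ∀ x y → -1ℤ *ᶻ 1ℤ *ᶻ 0ℤ *ᶻ x +ᶻ (1ℤ *ᶻ 1ℤ *ᶻ y +ᶻ 0ℤ) ≡ y
  simplify = solve-∀

power-zero : ∀ k → power 0 k ≡ δ k
power-zero k = trans (ℤ.*-identityˡ _) (trinomialCoeff-zero k)

U-power : ∀ n k → U n (λ m → power m k) ≡ chebyshev n k
U-power 0             k = trans (U-zero (λ m → power m k)) (power-zero k)
U-power 1             k = trans (U-one (λ m → power m k)) (trans (power-suc 0 k) (trinomial-cong power-zero k))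
U-power (suc (suc n)) k = trans (U-suc n (λ m → power m k)) (cong₂ _-ᶻ_
  (trans (U-cong (1 + n) (λ m → power-suc m k)) (trans (U-trinomial (1 + n) power k) (trinomial-cong (U-power (suc n)) k)))
  (U-power n k))

coeff-+ₚ : ∀ p q k → coeff (p +ₚ q) k ≡ coeff p k +ᶻ coeff q k
coeff-+ₚ []      q       k       = sym (ℤ.+-identityˡ _)
coeff-+ₚ (a ∷ p) []      k       = sym (ℤ.+-identityʳ _)
coeff-+ₚ (a ∷ p) (b ∷ q) zero    = refl
coeff-+ₚ (a ∷ p) (b ∷ q) (suc k) = coeff-+ₚ p q k

coeff-sumFromTo : ∀ a b f k → coeff (sumFromTo a b f) k ≡ Σ< (suc b ∸ a) (λ j → coeff (f (a + j)) k)
coeff-sumFromTo a b f k = go (suc b ∸ a) id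
  where
  go : ∀ m (h : ℕ → ℕ) → coeff (sumₚ (map f (map (λ j → a + j) (applyUpTo h m)))) k ≡ Σ< m (λ j → coeff (f (a + h j)) k)
  go zero    h = refl
  go (suc m) h = trans (coeff-+ₚ (f (a + h 0)) _ k) (cong (coeff (f (a + h 0)) k +ᶻ_) (go m (h ∘ suc)))

mono : ℕ → ℤ → ℕ → ℤ
mono l a = coeff (x^ l · const a)

mono-0 : ∀ l k → mono l 0ℤ k ≡ 0ℤ
mono-0 zero    zero    = refl
mono-0 zero    (suc k) = refl
mono-0 (suc l) zero    = refl
mono-0 (suc l) (suc k) = mono-0 l k

mono-+ : ∀ l a b k → mono l (a +ᶻ b) k ≡ mono l a k +ᶻ mono l b k
mono-+ zero    a b zero    = refl
mono-+ zero    a b (suc k) = refl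
mono-+ (suc l) a b zero    = refl
mono-+ (suc l) a b (suc k) = mono-+ l a b k

mono-Σ< : ∀ l m g k → Σ< m (λ i → mono l (g i) k) ≡ mono l (Σ< m g) k
mono-Σ< l zero    g k = sym (mono-0 l k)
mono-Σ< l (suc m) g k = trans (cong (mono l (g 0) k +ᶻ_) (mono-Σ< l m (g ∘ suc) k)) (sym (mono-+ l (g 0) _ k))

Σ<-mono : ∀ m (w : ℕ → ℤ) → (∀ {l} → m ≤ l → w l ≡ 0ℤ) → ∀ k → Σ< m (λ l → mono l (w l) k) ≡ w k
Σ<-mono zero    w z k       = sym (z z≤n)
Σ<-mono (suc m) w z zero    = trans (cong (w 0 +ᶻ_) (Σ<-zero m (λ _ → refl))) (ℤ.+-identityʳ (w 0))
Σ<-mono (suc m) w z (suc k) = trans (ℤ.+-identityˡ _) (Σ<-mono m (w ∘ suc) (z ∘ s≤s) k)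

<⌈/⌉ : ∀ {m d i} .{{_ : NonZero d}} → i < ⌈ m / d ⌉ → i * d < m
<⌈/⌉ {m} {d@(suc d-1)} {i} i<c = +-cancelʳ-≤ d-1 (suc (i * d)) m (begin
  suc (i * d) + d-1        ≡⟨ +-comm (suc (i * d)) d-1 ⟩
  d-1 + suc (i * d)        ≡⟨ +-suc d-1 (i * d) ⟩
  suc i * d                ≤⟨ *-monoˡ-≤ d i<c ⟩
  (m + d-1) / d * d        ≤⟨ m/n*n≤m (m + d-1) d ⟩
  m + d-1                  ∎)
  where open ≤-Reasoning

⌈/⌉≤ : ∀ {m d i} .{{_ : NonZero d}} → ⌈ m / d ⌉ ≤ i → m ≤ i * d
⌈/⌉≤ {m} {d@(suc d-1)} {i} c≤i = +-cancelʳ-≤ d-1 m (i * d) (begin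
  m + d-1                                  ≡⟨ m≡m%n+[m/n]*n (m + d-1) d ⟩
  (m + d-1) % d + (m + d-1) / d * d        ≤⟨ +-mono-≤ (≤-pred (m%n<n (m + d-1) d)) (*-monoˡ-≤ d c≤i) ⟩
  d-1 + i * d                              ≡⟨ +-comm d-1 (i * d) ⟩
  i * d + d-1                              ∎)
  where open ≤-Reasoning

term : ℕ → ℕ → ℕ → ℕ → ℤ
term n l i j = (-1ℤ ^ᶻ (n ∸ i)) *ᶻ + (2 ^ (2 * i ∸ n) * (i C (2 * i ∸ n)) * ((2 * i ∸ n) C j) * (j C (l ∸ j)))

term≡ : ∀ n l i j → n ≤ 2 * i → i ≤ n →
  term n l i j ≡ Ucoeff n i *ᶻ + (2 ^ (2 * i ∸ n)) *ᶻ trinomialTerm (2 * i ∸ n) l j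
term≡ n l i j n≤2i i≤n = begin
  s *ᶻ + (2 ^ m * (i C m) * (m C j) * (j C (l ∸ j)))
    ≡⟨ cong (λ c → s *ᶻ + (2 ^ m * c * (m C j) * (j C (l ∸ j)))) symm ⟩
  s *ᶻ + (2 ^ m * (i C (n ∸ i)) * (m C j) * (j C (l ∸ j)))
    ≡⟨ cong (s *ᶻ_) (trans (ℤ.pos-* (2 ^ m * (i C (n ∸ i)) * (m C j)) (j C (l ∸ j))) (cong (_*ᶻ + (j C (l ∸ j)))
         (trans (ℤ.pos-* (2 ^ m * (i C (n ∸ i))) (m C j)) (cong (_*ᶻ + (m C j)) (ℤ.pos-* (2 ^ m) (i C (n ∸ i))))))) ⟩
  s *ᶻ (+ (2 ^ m) *ᶻ + (i C (n ∸ i)) *ᶻ + (m C j) *ᶻ + (j C (l ∸ j)))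
    ≡⟨ cong (s *ᶻ_) (cong₂ _*ᶻ_ (cong₂ _*ᶻ_ (cong (+ (2 ^ m) *ᶻ_) (binom≡ i (n ∸ i))) (binom≡ m j)) (binom≡ j (l ∸ j))) ⟨
  s *ᶻ (+ (2 ^ m) *ᶻ binom i (n ∸ i) *ᶻ binom m j *ᶻ binom j (l ∸ j))
    ≡⟨ regroup s (+ (2 ^ m)) (binom i (n ∸ i)) (binom m j) (binom j (l ∸ j)) ⟩
  s *ᶻ binom i (n ∸ i) *ᶻ + (2 ^ m) *ᶻ (binom m j *ᶻ binom j (l ∸ j)) ∎
  where
  open ≡-Reasoning
  m = 2 * i ∸ n
  s = -1ℤ ^ᶻ (n ∸ i)
  regroup : ∀ s p b c d → s *ᶻ (p *ᶻ b *ᶻ c *ᶻ d) ≡ s *ᶻ b *ᶻ p *ᶻ (c *ᶻ d)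
  regroup = solve-∀
  m+[n∸i]≡i : m + (n ∸ i) ≡ i
  m+[n∸i]≡i = +-cancelʳ-≡ i (m + (n ∸ i)) i (begin
    m + (n ∸ i) + i    ≡⟨ +-assoc m (n ∸ i) i ⟩
    m + (n ∸ i + i)    ≡⟨ cong (λ r → m + r) (m∸n+n≡m i≤n) ⟩
    m + n              ≡⟨ m∸n+n≡m n≤2i ⟩
    2 * i              ≡⟨ cong (λ r → i + r) (+-identityʳ i) ⟩
    i + i              ∎)
  symm : i C m ≡ i C (n ∸ i)
  symm = trans (nCk≡nC[n∸k] (subst (m ≤_) m+[n∸i]≡i (m≤m+n m (n ∸ i))))
    (cong (i C_) (trans (cong (_∸ m) (sym m+[n∸i]≡i)) (m+n∸m≡n m (n ∸ i))))

innerSum : ℕ → ℕ → ℕ → ℤ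
innerSum n l i = Σ< (suc l ∸ ⌈ l / 2 ⌉) (λ j → term n l i (⌈ l / 2 ⌉ + j))

innerSum≡ : ∀ n l i → n ≤ 2 * i → i ≤ n → innerSum n l i ≡ Uterm n (λ m → power m l) i
innerSum≡ n l i n≤2i i≤n = begin
  innerSum n l i
    ≡⟨ Σ<-from ⌈ l / 2 ⌉ (suc l) {h = λ j → c *ᶻ trinomialTerm m l j} (λ {j} _ _ → term≡ n l i j n≤2i i≤n) vanishes ⟩
  Σ< (suc l) (λ j → c *ᶻ trinomialTerm m l j)
    ≡⟨ Σ<-* (suc l) c (trinomialTerm m l) ⟩
  c *ᶻ trinomialCoeff m l
    ≡⟨ ℤ.*-assoc (Ucoeff n i) (+ (2 ^ m)) (trinomialCoeff m l) ⟩
  Uterm n (λ m → power m l) i ∎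
  where
  open ≡-Reasoning
  m = 2 * i ∸ n
  c = Ucoeff n i *ᶻ + (2 ^ m)
  vanishes : ∀ {j} → j < ⌈ l / 2 ⌉ → c *ᶻ trinomialTerm m l j ≡ 0ℤ
  vanishes {j} j<c = trans (cong (c *ᶻ_) (trinomialTerm-vanishes m l j
    (subst (_< l) (trans (*-comm j 2) (cong (λ r → j + r) (+-identityʳ j))) (<⌈/⌉ j<c)))) (ℤ.*-zeroʳ c)

coefficient : ℕ → ℕ → ℤ
coefficient n l = Σ< (suc n ∸ ⌈ l + 2 * n / 4 ⌉) (λ i → innerSum n l (⌈ l + 2 * n / 4 ⌉ + i))

Uterm-power-vanishes : ∀ n l i → i * 4 < l + 2 * n → Uterm n (λ m → power m l) i ≡ 0ℤ
Uterm-power-vanishes n l i 4i<l+2n with n ≤? 2 * i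
... | no  n≰2i = trans (cong (λ b → (-1ℤ ^ᶻ (n ∸ i)) *ᶻ b *ᶻ power (2 * i ∸ n) l) (binom-> i<n∸i))
    (cong (_*ᶻ power (2 * i ∸ n) l) (ℤ.*-zeroʳ (-1ℤ ^ᶻ (n ∸ i))))
  where
  i<n∸i : i < n ∸ i
  i<n∸i = m+n≤o⇒m≤o∸n (suc i) (subst (λ j → i + j < n) (+-identityʳ i) (≰⇒> n≰2i))
... | yes n≤2i = trans (cong (λ t → Ucoeff n i *ᶻ (+ (2 ^ m) *ᶻ t)) (trinomialCoeff-vanishes m l 2m<l))
    (trans (cong (Ucoeff n i *ᶻ_) (ℤ.*-zeroʳ (+ (2 ^ m)))) (ℤ.*-zeroʳ (Ucoeff n i)))
  where
  m = 2 * i ∸ n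
  2m<l : m + m < l
  2m<l = +-cancelʳ-< (2 * n) (m + m) l (subst (_< l + 2 * n) (sym eq) 4i<l+2n)
    where
    open ≡-Reasoning
    eq : m + m + 2 * n ≡ i * 4
    eq = begin
      m + m + 2 * n      ≡⟨ cong (λ r → m + m + r) (cong (λ r → n + r) (+-identityʳ n)) ⟩
      m + m + (n + n)    ≡⟨ +-assoc m m (n + n) ⟩
      m + (m + (n + n))  ≡⟨ cong (λ r → m + r) (trans (sym (+-assoc m n n)) (+-comm (m + n) n)) ⟩
      m + (n + (m + n))  ≡⟨ +-assoc m n (m + n) ⟨
      (m + n) + (m + n)  ≡⟨ cong (λ r → r + r) (m∸n+n≡m n≤2i) ⟩
      2 * i + 2 * i      ≡⟨ *-distribʳ-+ i 2 2 ⟨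
      4 * i              ≡⟨ *-comm 4 i ⟩
      i * 4              ∎

coefficient≡chebyshev : ∀ n l → coefficient n l ≡ chebyshev n l
coefficient≡chebyshev n l = trans
  (Σ<-from ⌈ l + 2 * n / 4 ⌉ (suc n) {h = Uterm n (λ m → power m l)}
    (λ {i} a≤i i<b → innerSum≡ n l i (n≤2i i a≤i) (≤-pred i<b)) (λ {i} i<a → Uterm-power-vanishes n l i (<⌈/⌉ i<a)))
  (U-power n l)
  where
  n≤2i : ∀ i → ⌈ l + 2 * n / 4 ⌉ ≤ i → n ≤ 2 * i
  n≤2i i a≤i = *-cancelˡ-≤ 2 (begin
    2 * n        ≤⟨ m≤n+m (2 * n) l ⟩
    l + 2 * n    ≤⟨ ⌈/⌉≤ a≤i ⟩
    i * 4        ≡⟨ *-comm i 4 ⟩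
    4 * i        ≡⟨ *-assoc 2 2 i ⟩
    2 * (2 * i)  ∎)
    where open ≤-Reasoning

chebyshev-vanishes : ∀ n {l} → 2 * n < l → chebyshev n l ≡ 0ℤ
chebyshev-vanishes n {l} 2n<l = trans (sym (U-power n l)) (Σ<-zero (suc n) λ {i} i≤n →
  Uterm-power-vanishes n l i (begin-strict
    i * 4          ≡⟨ *-comm i 4 ⟩
    4 * i          ≤⟨ *-monoʳ-≤ 4 (≤-pred i≤n) ⟩
    4 * n          ≡⟨ *-distribʳ-+ n 2 2 ⟩
    2 * n + 2 * n  <⟨ +-monoˡ-< (2 * n) 2n<l ⟩
    l + 2 * n      ∎))
  where open ≤-Reasoning

row : ℕ → ℕ → ℕ → Poly
row n l i = Σ[ j from ⌈ l / 2 ⌉ to l ] x^ l · const (term n l i j)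

layer : ℕ → ℕ → Poly
layer n l = Σ[ i from ⌈ l + 2 * n / 4 ⌉ to n ] row n l i

coeff-layer : ∀ n l k → coeff (layer n l) k ≡ mono l (chebyshev n l) k
coeff-layer n l k = begin
  coeff (layer n l) k
    ≡⟨ coeff-sumFromTo a n (row n l) k ⟩
  Σ< (suc n ∸ a) (λ i → coeff (row n l (a + i)) k)
    ≡⟨ Σ<-cong (suc n ∸ a) (λ {i} _ → trans (coeff-sumFromTo c l (λ j → x^ l · const (term n l (a + i) j)) k)
         (mono-Σ< l (suc l ∸ c) (λ j → term n l (a + i) (c + j)) k)) ⟩
  Σ< (suc n ∸ a) (λ i → mono l (innerSum n l (a + i)) k)
    ≡⟨ mono-Σ< l (suc n ∸ a) (λ i → innerSum n l (a + i)) k ⟩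
  mono l (coefficient n l) k
    ≡⟨ cong (λ t → mono l t k) (coefficient≡chebyshev n l) ⟩
  mono l (chebyshev n l) k ∎
  where
  open ≡-Reasoning
  a = ⌈ l + 2 * n / 4 ⌉
  c = ⌈ l / 2 ⌉

tripleSum : ℕ → Poly
tripleSum n = Σ[ l from 0 to 2 * n ] layer n l

coeff-tripleSum : ∀ n k → coeff (tripleSum n) k ≡ chebyshev n k
coeff-tripleSum n k = begin
  coeff (tripleSum n) k
    ≡⟨ coeff-sumFromTo 0 (2 * n) (layer n) k ⟩
  Σ< (suc (2 * n)) (λ l → coeff (layer n l) k)
    ≡⟨ Σ<-cong (suc (2 * n)) (λ {l} _ → coeff-layer n l k) ⟩
  Σ< (suc (2 * n)) (λ l → mono l (chebyshev n l) k)
    ≡⟨ Σ<-mono (suc (2 * n)) (chebyshev n) (chebyshev-vanishes n) k ⟩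
  chebyshev n k ∎
  where open ≡-Reasoning

-- Counting words by weight

Σ∈ : ∀ {Y : Set} → List Y → (Y → ℤ) → ℤ
Σ∈ ys g = foldr _+ᶻ_ 0ℤ (map g ys)

Σ∈-cong : ∀ {Y : Set} (ys : List Y) {g h} → (∀ {y} → y ∈ ys → g y ≡ h y) → Σ∈ ys g ≡ Σ∈ ys h
Σ∈-cong []       e = refl
Σ∈-cong (y ∷ ys) e = cong₂ _+ᶻ_ (e (here refl)) (Σ∈-cong ys (e ∘ there))

Σ∈-++ : ∀ {Y : Set} (xs ys : List Y) g → Σ∈ (xs ++ ys) g ≡ Σ∈ xs g +ᶻ Σ∈ ys g
Σ∈-++ []       ys g = sym (ℤ.+-identityˡ _)
Σ∈-++ (x ∷ xs) ys g = trans (cong (g x +ᶻ_) (Σ∈-++ xs ys g)) (sym (ℤ.+-assoc (g x) _ _))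

Σ∈-concatMap : ∀ {Y Z : Set} (f : Y → List Z) ys g → Σ∈ (concatMap f ys) g ≡ Σ∈ ys (λ y → Σ∈ (f y) g)
Σ∈-concatMap f []       g = refl
Σ∈-concatMap f (y ∷ ys) g = trans (Σ∈-++ (f y) (concatMap f ys) g) (cong (Σ∈ (f y) g +ᶻ_) (Σ∈-concatMap f ys g))

Σ∈-map : ∀ {Y Z : Set} (f : Y → Z) ys g → Σ∈ (map f ys) g ≡ Σ∈ ys (g ∘ f)
Σ∈-map f ys g = cong (foldr _+ᶻ_ 0ℤ) (sym (map-∘ ys))

Σ∈-↭ : ∀ {Y : Set} {xs ys : List Y} g → xs ↭ ys → Σ∈ xs g ≡ Σ∈ ys g
Σ∈-↭ g ↭-refl        = refl
Σ∈-↭ g (prep x p)    = cong (g x +ᶻ_) (Σ∈-↭ g p)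
Σ∈-↭ g (swap x y p)  = trans (cong (λ s → g x +ᶻ (g y +ᶻ s)) (Σ∈-↭ g p)) (exchange (g x) (g y) _)
  where
  exchange : ∀ a b c → a +ᶻ (b +ᶻ c) ≡ b +ᶻ (a +ᶻ c)
  exchange = solve-∀
Σ∈-↭ g (↭-trans p q) = trans (Σ∈-↭ g p) (Σ∈-↭ g q)

coeff-sumₚ : ∀ {Y : Set} (f : Y → Poly) ys k → coeff (sumₚ (map f ys)) k ≡ Σ∈ ys (λ y → coeff (f y) k)
coeff-sumₚ f []       k = refl
coeff-sumₚ f (y ∷ ys) k = trans (coeff-+ₚ (f y) _ k) (cong (coeff (f y) k +ᶻ_) (coeff-sumₚ f ys k))

shiftBy : ℕ → (ℕ → ℤ) → ℕ → ℤ
shiftBy zero    s = s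
shiftBy (suc w) s = X (shiftBy w s)

shiftBy-cong : ∀ w {s t} → (∀ k → s k ≡ t k) → ∀ k → shiftBy w s k ≡ shiftBy w t k
shiftBy-cong zero    e = e
shiftBy-cong (suc w) e = X-cong (shiftBy-cong w e)

coeff-x^ : ∀ w p k → coeff (x^ w · p) k ≡ shiftBy w (coeff p) k
coeff-x^ zero    p k       = refl
coeff-x^ (suc w) p zero    = refl
coeff-x^ (suc w) p (suc k) = coeff-x^ w p k

mono-shiftBy : ∀ w l a k → mono (w + l) a k ≡ shiftBy w (mono l a) k
mono-shiftBy zero    l a k       = refl
mono-shiftBy (suc w) l a zero    = refl
mono-shiftBy (suc w) l a (suc k) = mono-shiftBy w l a k

Σ∈-shiftBy : ∀ {Y : Set} w (ys : List Y) (g : Y → ℕ → ℤ) k → Σ∈ ys (λ y → shiftBy w (g y) k) ≡ shiftBy w (λ k → Σ∈ ys (λ y → g y k)) k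
Σ∈-shiftBy zero    ys g k       = refl
Σ∈-shiftBy (suc w) ys g zero    = zeros ys
  where
  zeros : ∀ ys → Σ∈ ys (λ _ → 0ℤ) ≡ 0ℤ
  zeros []       = refl
  zeros (y ∷ ys) = trans (ℤ.+-identityˡ _) (zeros ys)
Σ∈-shiftBy (suc w) ys g (suc k) = Σ∈-shiftBy w ys g k

wordCount : Letter → ℕ → ℕ → ℤ
wordCount p n k = Σ∈ (words p n) (λ bs → mono (sum (map wt bs)) 1ℤ k)

wordCount-suc : ∀ p n k → wordCount p (suc n) k ≡ Σ∈ (successors p) (λ b → shiftBy (wt b) (wordCount b n) k)
wordCount-suc p n k = trans (Σ∈-concatMap (λ b → map (b ∷_) (words b n)) (successors p) _)
  (Σ∈-cong (successors p) λ {b} _ → begin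
    Σ∈ (map (b ∷_) (words b n)) (λ bs → mono (sum (map wt bs)) 1ℤ k)
      ≡⟨ Σ∈-map (b ∷_) (words b n) _ ⟩
    Σ∈ (words b n) (λ bs → mono (wt b + sum (map wt bs)) 1ℤ k)
      ≡⟨ Σ∈-cong (words b n) (λ {bs} _ → mono-shiftBy (wt b) (sum (map wt bs)) 1ℤ k) ⟩
    Σ∈ (words b n) (λ bs → shiftBy (wt b) (mono (sum (map wt bs)) 1ℤ) k)
      ≡⟨ Σ∈-shiftBy (wt b) (words b n) (λ bs → mono (sum (map wt bs)) 1ℤ) k ⟩
    shiftBy (wt b) (wordCount b n) k ∎)
  where open ≡-Reasoning

words-≢B : ∀ p n → isB p ≡ false → words p n ≡ words RR n
words-≢B p  zero    _ = refl
words-≢B A  (suc n) _ = refl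
words-≢B LL (suc n) _ = refl
words-≢B RR (suc n) _ = refl
words-≢B LR (suc n) _ = refl
words-≢B RL (suc n) _ = refl

X³ X² : (ℕ → ℤ) → ℕ → ℤ
X² s = X (X s)
X³ s = X (X² s)

-- Words at the start or after a letter other than B, and words after B.
free tied : ℕ → ℕ → ℤ
free = wordCount RR
tied = wordCount B

wordCount-≢B : ∀ w p n k → isB p ≡ false → shiftBy w (wordCount p n) k ≡ shiftBy w (free n) k
wordCount-≢B w p n k e = shiftBy-cong w (λ k → cong (λ ws → Σ∈ ws (λ bs → mono (sum (map wt bs)) 1ℤ k)) (words-≢B p n e)) k

tied-suc : ∀ n k → tied (suc n) k ≡ X (tied n) k +ᶻ + 2 *ᶻ (X² (free n) k +ᶻ X³ (free n) k)
tied-suc n k = trans (wordCount-suc B n k) (trans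
  (cong₂ (λ a b → X (tied n) k +ᶻ (a +ᶻ (X³ (free n) k +ᶻ b))) (wordCount-≢B 3 LL n k refl)
    (cong₂ (λ a b → a +ᶻ (b +ᶻ 0ℤ)) (wordCount-≢B 2 LR n k refl) (wordCount-≢B 2 RL n k refl)))
  (collect (X (tied n) k) (X² (free n) k) (X³ (free n) k)))
  where
  collect : ∀ t u v → t +ᶻ (v +ᶻ (v +ᶻ (u +ᶻ (u +ᶻ 0ℤ)))) ≡ t +ᶻ + 2 *ᶻ (u +ᶻ v)
  collect = solve-∀

free-suc : ∀ n k → free (suc n) k ≡ X (free n) k +ᶻ tied (suc n) k
free-suc n k = trans (wordCount-suc RR n k) (cong₂ _+ᶻ_ (wordCount-≢B 1 A n k refl) (sym (wordCount-suc B n k)))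

free-recurrence : ∀ n k → free (2 + n) k ≡ X (trinomial (free (1 + n))) k -ᶻ X (X (free n)) k
free-recurrence n zero = trans (free-suc (1 + n) 0) (trans (cong (0ℤ +ᶻ_) (tied-suc (1 + n) 0)) refl)
free-recurrence n (suc k) = begin
  free (2 + n) (suc k)
    ≡⟨ trans (free-suc (1 + n) (suc k)) (cong (free (1 + n) k +ᶻ_) (tied-suc (1 + n) (suc k))) ⟩
  free (1 + n) k +ᶻ (tied (1 + n) k +ᶻ + 2 *ᶻ (X (free (1 + n)) k +ᶻ X² (free (1 + n)) k))
    ≡⟨ cong (λ f → f +ᶻ (tied (1 + n) k +ᶻ + 2 *ᶻ (X (free (1 + n)) k +ᶻ X² (free (1 + n)) k))) (free-suc n k) ⟩
  (X (free n) k +ᶻ tied (1 + n) k) +ᶻ (tied (1 + n) k +ᶻ + 2 *ᶻ (X (free (1 + n)) k +ᶻ X² (free (1 + n)) k))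
    ≡⟨ collect (X (free n) k) (tied (1 + n) k) (X (free (1 + n)) k) (X² (free (1 + n)) k) ⟩
  + 2 *ᶻ ((X (free n) k +ᶻ tied (1 + n) k) +ᶻ X (free (1 + n)) k +ᶻ X² (free (1 + n)) k) -ᶻ X (free n) k
    ≡⟨ cong (λ f → + 2 *ᶻ (f +ᶻ X (free (1 + n)) k +ᶻ X² (free (1 + n)) k) -ᶻ X (free n) k) (free-suc n k) ⟨
  trinomial (free (1 + n)) k -ᶻ X (free n) k ∎
  where
  open ≡-Reasoning
  collect : ∀ f t x y → (f +ᶻ t) +ᶻ (t +ᶻ + 2 *ᶻ (x +ᶻ y)) ≡ + 2 *ᶻ ((f +ᶻ t) +ᶻ x +ᶻ y) -ᶻ f
  collect = solve-∀

X-trinomial : ∀ s k → trinomial (X s) k ≡ X (trinomial s) k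
X-trinomial s zero    = refl
X-trinomial s (suc k) = refl

shiftBy-trinomial : ∀ w s k → trinomial (shiftBy w s) k ≡ shiftBy w (trinomial s) k
shiftBy-trinomial zero    s k = refl
shiftBy-trinomial (suc w) s k = trans (X-trinomial (shiftBy w s) k) (X-cong (shiftBy-trinomial w s) k)

shiftBy-minus : ∀ w s t k → shiftBy w (λ k → s k -ᶻ t k) k ≡ shiftBy w s k -ᶻ shiftBy w t k
shiftBy-minus zero    s t k       = refl
shiftBy-minus (suc w) s t zero    = refl
shiftBy-minus (suc w) s t (suc k) = shiftBy-minus w s t k

free-0 : ∀ k → free 0 k ≡ δ k
free-0 zero    = refl
free-0 (suc k) = refl

tied-0 : ∀ k → tied 0 k ≡ δ k
tied-0 zero    = refl
tied-0 (suc k) = refl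

free≡chebyshev : ∀ n k → free n k ≡ shiftBy n (chebyshev n) k
free≡chebyshev 0 k = free-0 k
free≡chebyshev 1 k = begin
  free 1 k
    ≡⟨ trans (free-suc 0 k) (cong (X (free 0) k +ᶻ_) (tied-suc 0 k)) ⟩
  X (free 0) k +ᶻ (X (tied 0) k +ᶻ + 2 *ᶻ (X² (free 0) k +ᶻ X³ (free 0) k))
    ≡⟨ cong₂ _+ᶻ_ (X-cong free-0 k) (cong₂ _+ᶻ_ (X-cong tied-0 k) (cong (+ 2 *ᶻ_)
         (cong₂ _+ᶻ_ (X-cong (X-cong free-0) k) (X-cong (X-cong (X-cong free-0)) k)))) ⟩
  X δ k +ᶻ (X δ k +ᶻ + 2 *ᶻ (X² δ k +ᶻ X³ δ k))
    ≡⟨ collect (X δ k) (X² δ k) (X³ δ k) ⟩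
  trinomial (X δ) k
    ≡⟨ X-trinomial δ k ⟩
  X (trinomial δ) k ∎
  where
  open ≡-Reasoning
  collect : ∀ x y z → x +ᶻ (x +ᶻ + 2 *ᶻ (y +ᶻ z)) ≡ + 2 *ᶻ (x +ᶻ y +ᶻ z)
  collect = solve-∀
free≡chebyshev (suc (suc n)) k = begin
  free (2 + n) k
    ≡⟨ free-recurrence n k ⟩
  X (trinomial (free (1 + n))) k -ᶻ X (X (free n)) k
    ≡⟨ cong₂ _-ᶻ_ (X-cong (λ k → trans (trinomial-cong (free≡chebyshev (suc n)) k) (shiftBy-trinomial (1 + n) (chebyshev (1 + n)) k)) k)
         (X-cong (X-cong (free≡chebyshev n)) k) ⟩
  shiftBy (2 + n) (trinomial (chebyshev (1 + n))) k -ᶻ shiftBy (2 + n) (chebyshev n) k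
    ≡⟨ shiftBy-minus (2 + n) (trinomial (chebyshev (1 + n))) (chebyshev n) k ⟨
  shiftBy (2 + n) (chebyshev (2 + n)) k ∎
  where open ≡-Reasoning

coeff-Af : ∀ {n} (PG : PyreneGraph n) k → coeff (Af (PyreneGraph.graph PG)) k ≡ free n k
coeff-Af {n} PG k = begin
  coeff (Af graph) k
    ≡⟨ coeff-sumₚ (λ M → x^ af graph M · const 1ℤ) (perfectMatchings graph) k ⟩
  Σ∈ (perfectMatchings graph) (λ M → mono (af graph M) 1ℤ k)
    ≡⟨ Σ∈-↭ (λ M → mono (af graph M) 1ℤ k) perfectMatchings-words ⟩
  Σ∈ (map (matching ∘ at) (words RR n)) (λ M → mono (af graph M) 1ℤ k)
    ≡⟨ Σ∈-map (matching ∘ at) (words RR n) (λ M → mono (af graph M) 1ℤ k) ⟩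
  Σ∈ (words RR n) (λ bs → mono (af graph (matching (at bs))) 1ℤ k)
    ≡⟨ Σ∈-cong (words RR n) (λ bs∈ → cong (λ w → mono w 1ℤ k) (af-word bs∈)) ⟩
  free n k ∎
  where
  open ≡-Reasoning
  open PyreneGraph PG using (graph)
  open Coding PG using (matching)
  open Enumeration PG

coeff-Af-H : ∀ n k → coeff (Af (H n)) k ≡ shiftBy n (chebyshev n) k
coeff-Af-H zero    zero    = refl
coeff-Af-H zero    (suc k) = refl
coeff-Af-H (suc n) k       = transport (H (suc n)) refl
  where
  -- G is a variable lest the list of perfect matchings of H (suc n) be evaluated.
  transport : ∀ G → PyreneGraph.graph (pyrene n) ≡ G → coeff (Af G) k ≡ shiftBy (suc n) (chebyshev (suc n)) k
  transport G refl = trans (coeff-Af (pyrene n) k) (free≡chebyshev (suc n) k)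

theorem4p2 : (n : ℕ) →
    Af (H n) ≈ₚ
    (x^ n · (Σ[ l from 0 to 2 * n ]
    Σ[ i from ⌈ l + 2 * n / 4 ⌉ to n ]
    Σ[ j from ⌈ l / 2 ⌉ to l ]
    x^ l · const ((-1ℤ ^ᶻ (n ∸ i)) *ᶻ + (2 ^ (2 * i ∸ n) * (i C (2 * i ∸ n)) * ((2 * i ∸ n) C j) * (j C (l ∸ j))))))
theorem4p2 n k = begin
  coeff (Af (H n)) k                ≡⟨ coeff-Af-H n k ⟩
  shiftBy n (chebyshev n) k         ≡⟨ shiftBy-cong n (coeff-tripleSum n) k ⟨
  shiftBy n (coeff (tripleSum n)) k ≡⟨ coeff-x^ n (tripleSum n) k ⟨
  coeff (x^ n · tripleSum n) k      ∎
  where open ≡-Reasoning
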